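{- The Menelaus system is decidable: there is an algorithm which, given any sequent $\vdash\Gamma$ of the Menelaus system, decides whether $\vdash\Gamma$ is derivable in it.
   Context: **$\Delta$-complexes.** A $\Delta$-complex $K$ consists of mutually disjoint sets $K_0,K_1,\ldots$ (elements of $K_n$ are $n$-cells) and functions (faces) $d^n_i\colon K_n\to K_{n-1}$, $n\ge 1$, $0\le i\le n$, with $d^{n-1}_j\circ d^n_l=d^{n-1}_{l-1}\circ d^n_j$ whenever $l-1\ge j$; superscripts are often omitted. $C_n$ is the free abelian group on $K_n$ and $\partial_n\colon C_n\to C_{n-1}$ is given by $\partial_n x=\sum_{i=0}^n(-1)^id_ix$. A face of a 2-cell is an *edge* of it; a face of an edge of a 2-cell is a *vertex* of that 2-cell; a face of a 1-cell is a *vertex* of it. A $\Delta$-complex is connected when any two distinct 0-cells are joined by a sequence of 0-cells in which any two consecutive ones are the pair of vertices of a 1-cell. Two 2-cells are *$w$-neighbours* ($w$ a 0-cell) when they share an edge having $w$ as a vertex. **$\mathcal M$-complexes.** An $\mathcal M$-complex is a connected $\Delta$-complex $L$ such that: (0) $L$ has finitely many cells; (1) $L_m=\emptyset$ for $m\ge3$, every 0-cell is a face of some 1-cell and every 1-cell is a face of some 2-cell; (2) two different faces map an element of $L_2$ (resp. $L_1$) to two different elements of $L_1$ (resp. $L_0$); (3) every 1-cell is an edge of exactly two 2-cells; (4) for every $w\in L_0$, any two elements of $L_w=\{u\in L_2\mid w \text{ is a vertex of }u\}$ are joined by a sequence of 2-cells in which consecutive ones are $w$-neighbours; (5) $H_2(L;\mathbf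 Z)=\mathrm{Ker}\,\partial_2\cong\mathbf Z$. **The Menelaus system.** Let $\mathcal W$ be a countable set (the alphabet). Atomic formulae are the sextuples of pairwise distinct elements of $\mathcal W$; the set of these is $F^6(\mathcal W)$. Formulae are built from atomic ones with two binary connectives $\diamond$ and $\leftrightarrow$. A sequent $\vdash\Gamma$ is a finite multiset $\Gamma$ of formulae. Axiomatic sequents: (i) for every $\mathcal M$-complex $L$ with $L_0\cup L_1\subseteq\mathcal W$, the sequent $\vdash\{\nu x\mid x\in L_2\}$ (a multiset indexed by $L_2$), where $\nu x=(d_1d_2x,d_0d_2x,d_0d_0x,d_0x,d_1x,d_2x)$; (ii) $\vdash(A,B,C,P,Q,R),(B,C,A,Q,R,P)$ and $\vdash(A,B,C,P,Q,R),(A,R,Q,P,C,B)$ for all $(A,B,C,P,Q,R)\in F^6(\mathcal W)$. Rules: cut: from $\vdash\Gamma,\varphi$ and $\vdash\Delta,\varphi$ infer $\vdash\Gamma,\Delta$; cut with empty cut formula: from $\vdash\Gamma$ and $\vdash\Delta$ infer $\vdash\Gamma,\Delta$; $\diamond$-introduction: from $\vdash\Gamma,\varphi$ and $\vdash\Gamma,\psi$ infer $\vdash\Gamma,\varphi\diamond\psi$; $\leftrightarrow$-introduction: from $\vdash\Gamma,\varphi$ and $\vdash\Delta,\psi$ infer $\vdash\Gamma,\Delta,\varphi\leftrightarrow\psi$. -}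

module Defs where

open import Algebra.Bundles using (RawGroup; AbelianGroup)
open import Algebra.Morphism.Structures using (module GroupMorphisms)
import Algebra.Definitions.RawMonoid as RawMonoidSum
import Algebra.Properties.Group as GroupProperties
open import Data.Fin.Base using (Fin; zero; suc; toℕ; inject₁; _≤_)
open import Data.Integer.Base using (ℤ; +-0-rawGroup)
open import Data.List.Base using (List; []; _∷_; _++_; map)
open import Data.List.Relation.Binary.Permutation.Propositional using (_↭_)
import Data.List.Relation.Unary.Enumerates.Setoid as Enumerates
import Data.List.Relation.Unary.Unique.Propositional as List
open import Data.Nat.Base as ℕ using (ℕ; zero; suc; z≤n; s≤s)
open import Data.Product.Base using (Σ; ∃; _×_; _,_; proj₁; proj₂)
open import Data.Sum.Base using (_⊎_; inj₁; inj₂)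
open import Data.Sum.Properties using (inj₁-injective; inj₂-injective)
open import Data.Vec.Base using (Vec; []; _∷_)
open import Data.Vec.Relation.Unary.All using ([]; _∷_)
open import Data.Vec.Relation.Unary.AllPairs using ([]; _∷_)
import Data.Vec.Relation.Unary.Unique.Propositional as Vec
open import Function.Base using (_∘_)
open import Function.Bundles using (_↔_; _↣_; Injection)
open import Level using (0ℓ)
open import Relation.Binary.Construct.Closure.ReflexiveTransitive using (Star)
open import Relation.Binary.PropositionalEquality
  using (_≡_; _≢_; refl; sym; trans; setoid; ≢-sym)
open import Relation.Nullary.Negation using (¬_)

Finite : Set → Set
Finite A = ∃ λ n → A ↔ Fin n

Countable : Set → Set
Countable A = Finite A ⊎ (A ↔ ℕ)

------------------------------------------------------------------------
-- Free abelian groups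

-- There are no quotient types, so the free abelian group on X is the
-- setoid of group expressions over X modulo the congruence generated by
-- the abelian group laws.

data Expr (X : Set) : Set where
  gen  : X → Expr X
  0#   : Expr X
  _⊕_  : Expr X → Expr X → Expr X
  ⊖_   : Expr X → Expr X

infixl 6 _⊕_
infix  8 ⊖_
infix  4 _≋_

data _≋_ {X : Set} : Expr X → Expr X → Set where
  ≋-refl    : ∀ {a} → a ≋ a
  ≋-sym     : ∀ {a b} → a ≋ b → b ≋ a
  ≋-trans   : ∀ {a b c} → a ≋ b → b ≋ c → a ≋ c
  ⊕-cong    : ∀ {a b c d} → a ≋ b → c ≋ d → a ⊕ c ≋ b ⊕ d
  ⊖-cong    : ∀ {a b} → a ≋ b → ⊖ a ≋ ⊖ b
  assoc     : ∀ a b c → (a ⊕ b) ⊕ c ≋ a ⊕ (b ⊕ c)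
  comm      : ∀ a b → a ⊕ b ≋ b ⊕ a
  identityˡ : ∀ a → 0# ⊕ a ≋ a
  inverseˡ  : ∀ a → ⊖ a ⊕ a ≋ 0#

freeAbelianGroup : Set → AbelianGroup 0ℓ 0ℓ
freeAbelianGroup X = record
  { Carrier = Expr X
  ; _≈_ = _≋_
  ; _∙_ = _⊕_
  ; ε = 0#
  ; _⁻¹ = ⊖_
  ; isAbelianGroup = record
    { isGroup = record
      { isMonoid = record
        { isSemigroup = record
          { isMagma = record
            { isEquivalence = record
              { refl = ≋-refl ; sym = ≋-sym ; trans = ≋-trans }
            ; ∙-cong = ⊕-cong
            }
          ; assoc = assoc
          }
        ; identity = identityˡ , λ a → ≋-trans (comm a 0#) (identityˡ a)
        }
      ; inverse = inverseˡ , λ a → ≋-trans (comm a (⊖ a)) (inverseˡ a)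
      ; ⁻¹-cong = ⊖-cong
      }
    ; comm = comm
    }
  }

module _ {X : Set} (G : AbelianGroup 0ℓ 0ℓ) where

  private module G = AbelianGroup G

  extend : (X → G.Carrier) → Expr X → G.Carrier
  extend f (gen x) = f x
  extend f 0#      = G.ε
  extend f (a ⊕ b) = extend f a G.∙ extend f b
  extend f (⊖ a)   = extend f a G.⁻¹

  extend-cong : ∀ f {a b} → a ≋ b → extend f a G.≈ extend f b
  extend-cong f ≋-refl        = G.refl
  extend-cong f (≋-sym p)     = G.sym (extend-cong f p)
  extend-cong f (≋-trans p q) = G.trans (extend-cong f p) (extend-cong f q)
  extend-cong f (⊕-cong p q)  = G.∙-cong (extend-cong f p) (extend-cong f q)
  extend-cong f (⊖-cong p)    = G.⁻¹-cong (extend-cong f p)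
  extend-cong f (assoc a b c) = G.assoc _ _ _
  extend-cong f (comm a b)    = G.comm _ _
  extend-cong f (identityˡ a) = G.identityˡ _
  extend-cong f (inverseˡ a)  = G.inverseˡ _

------------------------------------------------------------------------
-- Δ-complexes

record ΔComplex : Set₁ where
  field
    Cell : ℕ → Set
    -- d n i is the face function dᵢ from (n+1)-cells to n-cells.
    d    : ∀ n → Fin (suc (suc n)) → Cell (suc n) → Cell n
    -- dⱼ ∘ dₗ = dₗ₋₁ ∘ dⱼ for l - 1 ≥ j; here k stands for l - 1.
    d-d  : ∀ n (j k : Fin (suc (suc n))) → j ≤ k → ∀ x →
           d n j (d (suc n) (suc k) x) ≡ d n k (d (suc n) (inject₁ j) x)

module Complex (L : ΔComplex) where

  open ΔComplex L public

  -- Chains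

  C : ℕ → AbelianGroup 0ℓ 0ℓ
  C n = freeAbelianGroup (Cell n)

  private module C n = AbelianGroup (C n)

  -- (-1)ⁱ a
  signed : ∀ {n} → ℕ → C.Carrier n → C.Carrier n
  signed zero    a = a
  signed (suc i) a = ⊖ signed i a

  -- ∂ n is the boundary map from (n+1)-chains to n-chains.
  ∂ : ∀ n → C.Carrier (suc n) → C.Carrier n
  ∂ n = extend (C n) λ x → sum λ i → signed (toℕ i) (gen (d n i x))
    where open RawMonoidSum (C.rawMonoid n) using (sum)

  -- The kernel of ∂ n.  As ∂ n lowers dimension n+1 to n, Ker ∂₂ is Ker∂ 1.
  Ker∂ : ℕ → RawGroup 0ℓ 0ℓ
  Ker∂ n = record
    { Carrier = Σ (C.Carrier (suc n)) λ c → ∂ n c ≋ 0#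
    ; _≈_ = λ a b → proj₁ a ≋ proj₁ b
    ; _∙_ = λ (a , p) (b , q) → a ⊕ b , ≋-trans (⊕-cong p q) (identityˡ 0#)
    ; ε   = 0# , ≋-refl
    ; _⁻¹ = λ (a , p) → ⊖ a , ≋-trans (⊖-cong p) ε⁻¹≈ε
    }
    where open GroupProperties (C.group n) using (ε⁻¹≈ε)

  -- Incidence

  _IsEdgeOf_ : Cell 1 → Cell 2 → Set
  e IsEdgeOf u = ∃ λ i → d 1 i u ≡ e

  _IsVertexOf₁_ : Cell 0 → Cell 1 → Set
  w IsVertexOf₁ e = ∃ λ i → d 0 i e ≡ w

  _IsVertexOf₂_ : Cell 0 → Cell 2 → Set
  w IsVertexOf₂ u = ∃ λ e → e IsEdgeOf u × w IsVertexOf₁ e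

  Adjacent : Cell 0 → Cell 0 → Set
  Adjacent v w = ∃ λ e → (d 0 zero e ≡ v × d 0 (suc zero) e ≡ w)
                       ⊎ (d 0 zero e ≡ w × d 0 (suc zero) e ≡ v)

  Connected : Set
  Connected = ∀ v w → v ≢ w → Star Adjacent v w

  Neighbours : Cell 0 → Cell 2 → Cell 2 → Set
  Neighbours w u v = ∃ λ e → e IsEdgeOf u × e IsEdgeOf v × w IsVertexOf₁ e

record IsMComplex (L : ΔComplex) : Set where
  open Complex L
  open GroupMorphisms (Ker∂ 1) +-0-rawGroup using (IsGroupIsomorphism)
  field
    connected     : Connected
    finite        : Finite (Σ ℕ Cell)
    no-higher     : ∀ m → 3 ℕ.≤ m → ¬ Cell m
    vertex-face   : ∀ w → ∃ λ e → w IsVertexOf₁ e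
    edge-face     : ∀ e → ∃ λ u → e IsEdgeOf u
    edges-differ  : ∀ (u : Cell 2) i j → i ≢ j → d 1 i u ≢ d 1 j u
    vertices-differ : ∀ (e : Cell 1) i j → i ≢ j → d 0 i e ≢ d 0 j e
    two-sided     : ∀ e → ∃ λ u → ∃ λ v →
                    u ≢ v × e IsEdgeOf u × e IsEdgeOf v ×
                    (∀ t → e IsEdgeOf t → t ≡ u ⊎ t ≡ v)
    link-connected : ∀ w u v → w IsVertexOf₂ u → w IsVertexOf₂ v →
                     Star (Neighbours w) u v
    H₂≅ℤ          : ∃ λ (f : RawGroup.Carrier (Ker∂ 1) → ℤ) → IsGroupIsomorphism f

------------------------------------------------------------------------
-- Formulae

-- Distinctness is irrelevant, so that equality of atomic formulae is
-- equality of sextuples.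

record Sextuple (W : Set) : Set where
  constructor sextuple
  field
    letters   : Vec W 6
    .distinct : Vec.Unique letters

data Formula (W : Set) : Set where
  atomic : Sextuple W → Formula W
  _◇_    : Formula W → Formula W → Formula W
  _⟷_    : Formula W → Formula W → Formula W

infixr 6 _◇_ _⟷_

-- Lists represent multisets: derivability is closed under permutation by
-- the constructor `exchange` below.

Sequent : Set → Set
Sequent W = List (Formula W)

module _ {W : Set} {A B C P Q R : W} where

  rotate-distinct : Vec.Unique (A ∷ B ∷ C ∷ P ∷ Q ∷ R ∷ []) →
                    Vec.Unique (B ∷ C ∷ A ∷ Q ∷ R ∷ P ∷ [])
  rotate-distinct
    ( (AB ∷ AC ∷ AP ∷ AQ ∷ AR ∷ [])
    ∷ (BC ∷ BP ∷ BQ ∷ BR ∷ [])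
    ∷ (CP ∷ CQ ∷ CR ∷ [])
    ∷ (PQ ∷ PR ∷ [])
    ∷ (QR ∷ [])
    ∷ [] ∷ [])
    = (BC ∷ ≢-sym AB ∷ BQ ∷ BR ∷ BP ∷ [])
    ∷ (≢-sym AC ∷ CQ ∷ CR ∷ CP ∷ [])
    ∷ (AQ ∷ AR ∷ AP ∷ [])
    ∷ (QR ∷ ≢-sym PQ ∷ [])
    ∷ (≢-sym PR ∷ [])
    ∷ [] ∷ []

  switch-distinct : Vec.Unique (A ∷ B ∷ C ∷ P ∷ Q ∷ R ∷ []) →
                    Vec.Unique (A ∷ R ∷ Q ∷ P ∷ C ∷ B ∷ [])
  switch-distinct
    ( (AB ∷ AC ∷ AP ∷ AQ ∷ AR ∷ [])
    ∷ (BC ∷ BP ∷ BQ ∷ BR ∷ [])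
    ∷ (CP ∷ CQ ∷ CR ∷ [])
    ∷ (PQ ∷ PR ∷ [])
    ∷ (QR ∷ [])
    ∷ [] ∷ [])
    = (AR ∷ AQ ∷ AP ∷ AC ∷ AB ∷ [])
    ∷ (≢-sym QR ∷ ≢-sym PR ∷ ≢-sym CR ∷ ≢-sym BR ∷ [])
    ∷ (≢-sym PQ ∷ ≢-sym CQ ∷ ≢-sym BQ ∷ [])
    ∷ (≢-sym CP ∷ ≢-sym BP ∷ [])
    ∷ (≢-sym BC ∷ [])
    ∷ [] ∷ []

-- The disjoint sets L₀ and L₁ being contained in W amounts to an
-- injection ι of their disjoint sum into W.

module _ {W : Set} {L : ΔComplex} (M : IsMComplex L)
         (ι : (ΔComplex.Cell L 0 ⊎ ΔComplex.Cell L 1) ↣ W) where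

  open ΔComplex L
  open IsMComplex M

  private
    d₀ d₁ : Cell 1 → Cell 0
    d₀ = d 0 zero
    d₁ = d 0 (suc zero)

    e₀ e₁ e₂ : Cell 2 → Cell 1
    e₀ = d 1 zero
    e₁ = d 1 (suc zero)
    e₂ = d 1 (suc (suc zero))

    vertex : Cell 0 → W
    vertex = Injection.to ι ∘ inj₁

    edge : Cell 1 → W
    edge = Injection.to ι ∘ inj₂

    vertex-≢ : ∀ {v w} → v ≢ w → vertex v ≢ vertex w
    vertex-≢ v≢w = v≢w ∘ inj₁-injective ∘ Injection.injective ι

    edge-≢ : ∀ {e f} → e ≢ f → edge e ≢ edge f
    edge-≢ e≢f = e≢f ∘ inj₂-injective ∘ Injection.injective ι

    vertex≢edge : ∀ {v e} → vertex v ≢ edge e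
    vertex≢edge eq with () ← Injection.injective ι eq

    d₁≢d₀ : ∀ e → d₁ e ≢ d₀ e
    d₁≢d₀ e = vertices-differ e _ _ λ ()

    d₀e₁ : ∀ x → d₀ (e₁ x) ≡ d₀ (e₀ x)
    d₀e₁ = d-d 0 zero zero z≤n

    d₀e₂ : ∀ x → d₀ (e₂ x) ≡ d₁ (e₀ x)
    d₀e₂ = d-d 0 zero (suc zero) z≤n

    d₁e₂ : ∀ x → d₁ (e₂ x) ≡ d₁ (e₁ x)
    d₁e₂ = d-d 0 (suc zero) (suc zero) (s≤s z≤n)

    AB : ∀ x → d₁ (e₂ x) ≢ d₀ (e₂ x)
    AB x = d₁≢d₀ (e₂ x)

    AC : ∀ x → d₁ (e₂ x) ≢ d₀ (e₀ x)
    AC x eq = d₁≢d₀ (e₁ x) (trans (sym (d₁e₂ x)) (trans eq (sym (d₀e₁ x))))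

    BC : ∀ x → d₀ (e₂ x) ≢ d₀ (e₀ x)
    BC x eq = d₁≢d₀ (e₀ x) (trans (sym (d₀e₂ x)) eq)

  ν-letters : Cell 2 → Vec W 6
  ν-letters x = vertex (d₁ (e₂ x)) ∷ vertex (d₀ (e₂ x)) ∷ vertex (d₀ (e₀ x))
              ∷ edge (e₀ x) ∷ edge (e₁ x) ∷ edge (e₂ x) ∷ []

  ν-distinct : ∀ x → Vec.Unique (ν-letters x)
  ν-distinct x
    = (vertex-≢ (AB x) ∷ vertex-≢ (AC x) ∷ vertex≢edge ∷ vertex≢edge ∷ vertex≢edge ∷ [])
    ∷ (vertex-≢ (BC x) ∷ vertex≢edge ∷ vertex≢edge ∷ vertex≢edge ∷ [])
    ∷ (vertex≢edge ∷ vertex≢edge ∷ vertex≢edge ∷ [])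
    ∷ (edge-≢ (edges-differ x _ _ λ ()) ∷ edge-≢ (edges-differ x _ _ λ ()) ∷ [])
    ∷ (edge-≢ (edges-differ x _ _ λ ()) ∷ [])
    ∷ [] ∷ []

  ν : Cell 2 → Sextuple W
  ν x = sextuple (ν-letters x) (ν-distinct x)

------------------------------------------------------------------------
-- The Menelaus system

open Enumerates using (IsEnumeration)

infix 2 ⊢_

data ⊢_ {W : Set} : Sequent W → Set₁ where

  -- xs lists each 2-cell exactly once, so the sequent is the multiset of
  -- the νx indexed by L₂.
  complex : ∀ {L} (M : IsMComplex L)
            (ι : (ΔComplex.Cell L 0 ⊎ ΔComplex.Cell L 1) ↣ W)
            (xs : List (ΔComplex.Cell L 2)) →
            IsEnumeration (setoid _) xs → List.Unique xs →
            ⊢ map (atomic ∘ ν M ι) xs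

  rotate : ∀ {A B C P Q R}
           .(δ : Vec.Unique (A ∷ B ∷ C ∷ P ∷ Q ∷ R ∷ [])) →
           ⊢ atomic (sextuple (A ∷ B ∷ C ∷ P ∷ Q ∷ R ∷ []) δ)
           ∷ atomic (sextuple (B ∷ C ∷ A ∷ Q ∷ R ∷ P ∷ []) (rotate-distinct δ))
           ∷ []

  switch : ∀ {A B C P Q R}
           .(δ : Vec.Unique (A ∷ B ∷ C ∷ P ∷ Q ∷ R ∷ [])) →
           ⊢ atomic (sextuple (A ∷ B ∷ C ∷ P ∷ Q ∷ R ∷ []) δ)
           ∷ atomic (sextuple (A ∷ R ∷ Q ∷ P ∷ C ∷ B ∷ []) (switch-distinct δ))
           ∷ []

  exchange : ∀ {Γ Δ} → Γ ↭ Δ → ⊢ Γ → ⊢ Δ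

  cut       : ∀ {Γ Δ φ} → ⊢ φ ∷ Γ → ⊢ φ ∷ Δ → ⊢ Γ ++ Δ
  empty-cut : ∀ {Γ Δ} → ⊢ Γ → ⊢ Δ → ⊢ Γ ++ Δ
  ◇-intro   : ∀ {Γ φ ψ} → ⊢ φ ∷ Γ → ⊢ ψ ∷ Γ → ⊢ φ ◇ ψ ∷ Γ
  ⟷-intro   : ∀ {Γ Δ φ ψ} → ⊢ φ ∷ Γ → ⊢ ψ ∷ Δ → ⊢ φ ⟷ ψ ∷ Γ ++ Δ

{-# OPTIONS --safe #-}

-- Cuts on compound formulae can be eliminated, so backward application of the
-- ◇- and ⟷-rules reduces derivability to sequents of sextuples.  A derivable
-- sequent of sextuples has at least two members, and one with exactly two
-- only relates sextuples differing by rotations and switches.  Up to these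
-- symmetries every other cut and every empty cut has premises shorter than
-- its conclusion, which gives a recursion on the length; the letters of the
-- cut formula can be renamed into a finite pool containing the letters of the
-- conclusion.  Being an axiom (up to symmetry) is decided by a search through
-- tables of faces and labels: when links and the complex are connected and
-- every edge lies in two triangles, all coefficients of a 2-cycle have the
-- same absolute value, so H₂ ≅ ℤ amounts to the existence of a consistent
-- orientation, a finite condition.

module Submission where

-- Length alone does not bound a proof search: a cut with a two-member premise has a conclusion as
-- long as its other premise. Such a cut only exchanges one member for a symmetric one, so the
-- analysis of last rules is made invariant under such exchanges, and an induction on derivations
-- absorbs these cuts. That two-member sequents are so restricted rests on complexes with two
-- 2-cells: both have the same three edges, and the directions of the edges force the same numbering
-- of the faces, so both cells carry the same letters. Cuts on compound formulae involve no duality,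
-- because a formula is cut against itself and both occurrences are introduced by the same rule. An
-- axiom may come from a complex whose cells are of any type and have no given decidable equality.
-- Equality is recovered from the injective labelling by letters and from the enumeration of the
-- 2-cells; only then can the coefficients of chains be computed and the complex be copied to a
-- table over `Fin`.

open import Defs

open import Algebra.Bundles using (AbelianGroup)
open import Algebra.Morphism.Structures using (module GroupMorphisms)
import Algebra.Properties.AbelianGroup as AbelianGroupProperties
import Algebra.Properties.CommutativeSemigroup as CommutativeSemigroupProperties
open import Data.Bool.Base using (Bool; true; false)
import Data.Bool.Properties as Bool
open import Data.Empty using (⊥)
open import Data.Fin.Base as Fin using (Fin; zero; suc; toℕ; inject₁)
import Data.Fin.Properties as Fin
open import Data.Integer.Base as ℤ
  using (ℤ; +_; -[1+_]; 0ℤ; 1ℤ; _+_; _*_; -_; _≤_; +≤+; ∣_∣; +-0-rawGroup)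
import Data.Integer.Properties as ℤ
open import Data.Integer.Tactic.RingSolver using (solve-∀)
open import Data.List.Base as List
  using (List; []; _∷_; _++_; map; length; concatMap; cartesianProductWith; deduplicate; allFin; upTo)
open import Data.List.Extrema.Nat using (max; xs≤max)
import Data.List.Membership.DecPropositional as DecMembership
open import Data.List.Membership.Propositional using (_∈_; _∉_; lose)
open import Data.List.Membership.Propositional.Properties
  using (∈-∃++; ∈-++⁻; ∈-++⁺ˡ; ∈-++⁺ʳ; ∈-cartesianProductWith⁺; ∈-allFin; ∈-tabulate⁺; ∈-tabulate⁻
        ; ∈-deduplicate⁺; ∈-concatMap⁺; ∈-lookup; ∈-map⁺; ∈-upTo⁺)
open import Data.List.Properties
  using (map-++; map-∘; map-injective; map-id-local; map-tabulate; tabulate-lookup; ∷-injective; length-++)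
open import Data.List.Relation.Binary.Permutation.Propositional as ↭
  using (_↭_; prep; ↭-refl; ↭-reflexive; ↭-sym; ↭-trans; ↭⇒↭ₛ)
open import Data.List.Relation.Binary.Permutation.Propositional.Properties
  using (∈-resp-↭; drop-∷; ↭-empty-inv; ↭-singleton-inv; ↭-map-inv; ↭-length
        ; shift; map⁺; ++⁺; ++⁺ˡ; ++⁺ʳ; ++-comm; ++-assoc)
open import Data.List.Relation.Binary.Permutation.Setoid.Properties using (Unique-resp-↭)
open import Data.List.Relation.Binary.Pointwise as Pointwise using (Pointwise; []; _∷_)
import Data.List.Relation.Unary.All as All
import Data.List.Relation.Unary.All.Properties as All
import Data.List.Relation.Unary.AllPairs as AllPairs
open import Data.List.Relation.Unary.Any as Any using (here; there; index)
open import Data.List.Relation.Unary.Any.Properties using (lookup-index)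
open import Data.List.Relation.Unary.Enumerates.Setoid using (IsEnumeration)
import Data.List.Relation.Unary.Unique.DecPropositional.Properties as DecUnique
import Data.List.Relation.Unary.Unique.Propositional as List
import Data.List.Relation.Unary.Unique.Propositional.Properties as Unique
open import Data.Nat.Base as ℕ using (ℕ; zero; suc; s≤s; z≤n)
open import Data.Nat.Induction using (<-wellFounded)
open import Data.Nat.ListAction using (sum)
open import Data.Nat.ListAction.Properties using (sum-↭; sum-++)
import Data.Nat.Properties as ℕ
open import Data.Product.Base using (Σ; ∃; ∃₂; _×_; _,_; proj₁; proj₂)
open import Data.Sum.Base using (_⊎_; inj₁; inj₂; [_,_]′)
open import Data.Sum.Function.Propositional using (_⊎-↔_)
open import Data.Sum.Properties using (inj₁-injective; inj₂-injective)
open import Data.Unit.Base using (⊤; tt)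
open import Data.Vec.Base as Vec using (Vec; []; _∷_; lookup; tabulate; toList)
open import Data.Vec.Properties using (lookup∘tabulate; ≡-dec)
open import Data.Vec.Relation.Unary.All as VAll using ([]; _∷_)
import Data.Vec.Relation.Unary.All.Properties as VAll
import Data.Vec.Relation.Unary.AllPairs as VAllPairs
import Data.Vec.Relation.Unary.Unique.Propositional as Vec
import Data.Vec.Relation.Unary.Unique.Propositional.Properties as VecUnique
open import Function.Base using (_∘_; id)
open import Function.Bundles using (_↔_; _↣_; Inverse; Injection; mk↔ₛ′; mk↣)
import Function.Construct.Composition as Composition
open import Function.Construct.Identity using (↔-id; ↣-id)
import Function.Construct.Symmetry as Symmetry
open import Function.Properties.Inverse using (↔⇒↣)
open import Induction.WellFounded using (Acc; acc)
open import Level using (Lift)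
open import Relation.Binary.Construct.Closure.ReflexiveTransitive using (Star; ε; _◅_; _◅◅_; gmap)
open import Relation.Binary.Definitions using (DecidableEquality)
open import Relation.Binary.PropositionalEquality
  using (_≡_; _≢_; refl; sym; trans; cong; cong₂; subst; subst₂; setoid; ≢-sym; module ≡-Reasoning)
import Relation.Binary.Reasoning.Setoid as SetoidReasoning
open import Relation.Nullary.Decidable
  using (Dec; yes; no; map′; ¬?; _⊎-dec_; _×-dec_; _→-dec_; via-injection; toWitness; recompute)
open import Relation.Nullary.Negation using (¬_; contradiction)

-- Finite searches

module _ {A : Set} where

  ∈⇒↭∷ : ∀ {x : A} {xs} → x ∈ xs → ∃ λ ys → xs ↭ x ∷ ys
  ∈⇒↭∷ x∈xs with as , bs , refl ← ∈-∃++ x∈xs = as ++ bs , shift _ as bs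

  ∷↭∷-inv : ∀ {x y : A} {xs ys} → x ∷ xs ↭ y ∷ ys →
            (x ≡ y × xs ↭ ys) ⊎ ∃ λ zs → xs ↭ y ∷ zs × ys ↭ x ∷ zs
  ∷↭∷-inv {x} {y} p with ∈-resp-↭ (↭-sym p) (here refl)
  ... | here refl = inj₁ (refl , drop-∷ p)
  ... | there y∈xs with zs , q ← ∈⇒↭∷ y∈xs =
    inj₂ (zs , q , drop-∷ (↭-trans (↭-sym p) (↭-trans (prep x q) (↭.swap x y ↭-refl))))

  ∷↭++-inv : ∀ {x : A} {xs} ys {zs} → x ∷ xs ↭ ys ++ zs →
             (∃ λ ys′ → ys ↭ x ∷ ys′ × xs ↭ ys′ ++ zs) ⊎
             (∃ λ zs′ → zs ↭ x ∷ zs′ × xs ↭ ys ++ zs′)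
  ∷↭++-inv {x} ys {zs} p with ∈-++⁻ ys (∈-resp-↭ p (here refl))
  ... | inj₁ x∈ys with ys′ , q ← ∈⇒↭∷ x∈ys =
    inj₁ (ys′ , q , drop-∷ (↭-trans p (++⁺ʳ zs q)))
  ... | inj₂ x∈zs with zs′ , q ← ∈⇒↭∷ x∈zs =
    inj₂ (zs′ , q , drop-∷ (↭-trans p (↭-trans (++⁺ˡ ys q) (shift x ys zs′))))

  -- Invariance under permutations of the remainder makes it enough to test one remainder for each
  -- position. The test receives the permutation itself, from which its callers prove that their
  -- recursive calls descend; `any-split?` follows the same pattern.
  any-pick? : ∀ {p} {P : A → List A → Set p} xs →
              (∀ {y ys zs} → ys ↭ zs → P y ys → P y zs) →
              (∀ y ys → xs ↭ y ∷ ys → Dec (P y ys)) →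
              Dec (∃₂ λ y ys → xs ↭ y ∷ ys × P y ys)
  any-pick? [] resp P? =
    no λ (_ , _ , p , _) → contradiction (↭-empty-inv (↭-sym p)) λ ()
  any-pick? {P = P} (x ∷ xs) resp P? =
    map′ [ (λ Px → x , xs , ↭-refl , Px)
         , (λ (y , ys , p , Py) → y , x ∷ ys , ↭-trans (prep x p) (↭.swap x y ↭-refl) , Py) ]′
         complete
         (P? x xs ↭-refl ⊎-dec
          any-pick? {P = λ y ys → P y (x ∷ ys)} xs (resp ∘ prep x)
            λ y ys p → P? y (x ∷ ys) (↭-trans (prep x p) (↭.swap x y ↭-refl)))
    where
    complete : ∃₂ (λ y ys → x ∷ xs ↭ y ∷ ys × P y ys) →
               P x xs ⊎ ∃₂ λ y ys → xs ↭ y ∷ ys × P y (x ∷ ys)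
    complete (y , ys , p , Py) with ∷↭∷-inv p
    ... | inj₁ (refl , q) = inj₁ (resp (↭-sym q) Py)
    ... | inj₂ (zs , q , r) = inj₂ (y , zs , q , resp r Py)

  any-split? : ∀ {p} {P : List A → List A → Set p} xs →
               (∀ {ys ys′ zs zs′} → ys ↭ ys′ → zs ↭ zs′ → P ys zs → P ys′ zs′) →
               (∀ ys zs → xs ↭ ys ++ zs → Dec (P ys zs)) →
               Dec (∃₂ λ ys zs → xs ↭ ys ++ zs × P ys zs)
  any-split? {P = P} [] resp P? =
    map′ (λ P[] → [] , [] , ↭-refl , P[]) complete (P? [] [] ↭-refl)
    where
    complete : ∃₂ (λ ys zs → [] ↭ ys ++ zs × P ys zs) → P [] []
    complete ([] , [] , _ , P[]) = P[]
    complete ([] , _ ∷ _ , p , _) with () ← ↭-empty-inv (↭-sym p)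
    complete (_ ∷ _ , _ , p , _) with () ← ↭-empty-inv (↭-sym p)
  any-split? {P = P} (x ∷ xs) resp P? =
    map′ [ (λ (ys , zs , p , Pyz) → x ∷ ys , zs , prep x p , Pyz)
         , (λ (ys , zs , p , Pyz) → ys , x ∷ zs , right p , Pyz) ]′
         complete
         (any-split? {P = λ ys zs → P (x ∷ ys) zs} xs (resp ∘ prep x)
            (λ ys zs p → P? _ _ (prep x p))
          ⊎-dec
          any-split? {P = λ ys zs → P ys (x ∷ zs)} xs (λ q r → resp q (prep x r))
            (λ ys zs p → P? _ _ (right p)))
    where
    right : ∀ {ys zs} → xs ↭ ys ++ zs → x ∷ xs ↭ ys ++ x ∷ zs
    right {ys} {zs} p = ↭-trans (prep x p) (↭-sym (shift x ys zs))
    complete : ∃₂ (λ ys zs → x ∷ xs ↭ ys ++ zs × P ys zs) →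
               ∃₂ (λ ys zs → xs ↭ ys ++ zs × P (x ∷ ys) zs) ⊎
               ∃₂ (λ ys zs → xs ↭ ys ++ zs × P ys (x ∷ zs))
    complete (ys , zs , p , Pyz) with ∷↭++-inv ys p
    ... | inj₁ (ys′ , q , r) = inj₁ (ys′ , zs , r , resp q ↭-refl Pyz)
    ... | inj₂ (zs′ , q , r) = inj₂ (ys , zs′ , r , resp ↭-refl q Pyz)

  Pointwise-↭ : ∀ {B : Set} {r} {R : A → B → Set r} {xs ys zs} →
                Pointwise R xs ys → ys ↭ zs → ∃ λ ws → xs ↭ ws × Pointwise R ws zs
  Pointwise-↭ rs ↭.refl = _ , ↭-refl , rs
  Pointwise-↭ (r ∷ rs) (prep _ p) with _ , q , rs′ ← Pointwise-↭ rs p =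
    _ , prep _ q , r ∷ rs′
  Pointwise-↭ (r ∷ r′ ∷ rs) (↭.swap _ _ p) with _ , q , rs′ ← Pointwise-↭ rs p =
    _ , ↭.swap _ _ q , r′ ∷ r ∷ rs′
  Pointwise-↭ rs (↭.trans p p′)
    with _ , q , rs′ ← Pointwise-↭ rs p
    with _ , q′ , rs″ ← Pointwise-↭ rs′ p′ = _ , ↭-trans q q′ , rs″

module _ {A : Set} (V : List A) where

  vectorsOver : ∀ n → List (Vec A n)
  vectorsOver zero    = [] ∷ []
  vectorsOver (suc n) = cartesianProductWith _∷_ V (vectorsOver n)

  ∈-vectorsOver : ∀ {n} {v : Vec A n} → VAll.All (_∈ V) v → v ∈ vectorsOver n
  ∈-vectorsOver []       = here refl
  ∈-vectorsOver (p ∷ ps) = ∈-cartesianProductWith⁺ _∷_ p (∈-vectorsOver ps)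

-- Functions between finite sets are searched for as vectors of values, which form an honest finite
-- type.
anyVec? : ∀ {m p} n {P : Vec (Fin m) n → Set p} → (∀ v → Dec (P v)) → Dec (∃ P)
anyVec? zero    P? = map′ ([] ,_) (λ { ([] , p) → p }) (P? [])
anyVec? (suc n) P? =
  map′ (λ (i , v , p) → i ∷ v , p) (λ { (i ∷ v , p) → i , v , p })
       (Fin.any? λ i → anyVec? n λ v → P? (i ∷ v))

-- Warshall's algorithm: Through xs a b holds when some path from a to b
-- has all its intermediate points in xs.
module _ {A : Set} {R : A → A → Set} where

  Through : List A → A → A → Set
  Through []       a b = a ≡ b ⊎ R a b
  Through (x ∷ xs) a b = Through xs a b ⊎ Through xs a x × Through xs x b

  Through-dec : DecidableEquality A → (∀ a b → Dec (R a b)) → ∀ xs a b → Dec (Through xs a b)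
  Through-dec _≟_ R? []       a b = (a ≟ b) ⊎-dec R? a b
  Through-dec _≟_ R? (x ∷ xs) a b =
    Through-dec _≟_ R? xs a b ⊎-dec
    (Through-dec _≟_ R? xs a x ×-dec Through-dec _≟_ R? xs x b)

  Through⇒Star : ∀ xs {a b} → Through xs a b → Star R a b
  Through⇒Star []       (inj₁ refl)    = ε
  Through⇒Star []       (inj₂ r)       = r ◅ ε
  Through⇒Star (x ∷ xs) (inj₁ p)       = Through⇒Star xs p
  Through⇒Star (x ∷ xs) (inj₂ (p , q)) = Through⇒Star xs p ◅◅ Through⇒Star xs q

  Through-base : ∀ xs {a b} → a ≡ b ⊎ R a b → Through xs a b
  Through-base []       p = p
  Through-base (x ∷ xs) p = inj₁ (Through-base xs p)

  -- Loops at the newest point `x` are cut out: of two paths that pass through `x`, only the part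
  -- before it in the first and the part after it in the second are kept.
  Through-trans : ∀ {xs a b c} → c ∈ xs → Through xs a c → Through xs c b → Through xs a b
  Through-trans (here refl) p q =
    inj₂ ([ id , proj₁ ]′ p , [ id , proj₂ ]′ q)
  Through-trans (there c∈xs) (inj₁ p) (inj₁ q) = inj₁ (Through-trans c∈xs p q)
  Through-trans (there c∈xs) (inj₁ p) (inj₂ (q , r)) = inj₂ (Through-trans c∈xs p q , r)
  Through-trans (there c∈xs) (inj₂ (p , q)) (inj₁ r) = inj₂ (p , Through-trans c∈xs q r)
  Through-trans (there c∈xs) (inj₂ (p , _)) (inj₂ (_ , q)) = inj₂ (p , q)

  module _ {P : A → Set} {xs} (step : ∀ {a b} → P a → R a b → P b) (P⊆xs : ∀ {a} → P a → a ∈ xs) where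

    Star⇒Through : ∀ {a b} → P a → Star R a b → Through xs a b
    Star⇒Through Pa ε = Through-base xs (inj₁ refl)
    Star⇒Through Pa (r ◅ rs) =
      Through-trans (P⊆xs (step Pa r)) (Through-base xs (inj₂ r)) (Star⇒Through (step Pa r) rs)

    -- The invariant `P` confines all points reachable from `a` to the list `xs`, so `A` itself may
    -- be infinite, as it is for sextuples over an infinite alphabet.
    Star-dec : DecidableEquality A → (∀ a b → Dec (R a b)) → ∀ {a} → P a → ∀ b → Dec (Star R a b)
    Star-dec _≟_ R? Pa b =
      map′ (Through⇒Star xs) (Star⇒Through Pa) (Through-dec _≟_ R? xs _ b)

-- Cut elimination

open Sextuple using (letters)

infix 2 ⊢ᵃ_

data ⊢ᵃ_ {W : Set} : List (Sextuple W) → Set₁ where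
  complexᵃ : ∀ {L} (M : IsMComplex L)
             (ι : (ΔComplex.Cell L 0 ⊎ ΔComplex.Cell L 1) ↣ W)
             (xs : List (ΔComplex.Cell L 2)) →
             IsEnumeration (setoid _) xs → List.Unique xs →
             ⊢ᵃ map (ν M ι) xs
  rotateᵃ : ∀ {A B C P Q R} .(δ : Vec.Unique (A ∷ B ∷ C ∷ P ∷ Q ∷ R ∷ [])) →
            ⊢ᵃ sextuple (A ∷ B ∷ C ∷ P ∷ Q ∷ R ∷ []) δ
             ∷ sextuple (B ∷ C ∷ A ∷ Q ∷ R ∷ P ∷ []) (rotate-distinct δ) ∷ []
  switchᵃ : ∀ {A B C P Q R} .(δ : Vec.Unique (A ∷ B ∷ C ∷ P ∷ Q ∷ R ∷ [])) →
            ⊢ᵃ sextuple (A ∷ B ∷ C ∷ P ∷ Q ∷ R ∷ []) δ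
             ∷ sextuple (A ∷ R ∷ Q ∷ P ∷ C ∷ B ∷ []) (switch-distinct δ) ∷ []
  exchangeᵃ  : ∀ {Γ Δ} → Γ ↭ Δ → ⊢ᵃ Γ → ⊢ᵃ Δ
  cutᵃ       : ∀ {Γ Δ φ} → ⊢ᵃ φ ∷ Γ → ⊢ᵃ φ ∷ Δ → ⊢ᵃ Γ ++ Δ
  empty-cutᵃ : ∀ {Γ Δ} → ⊢ᵃ Γ → ⊢ᵃ Δ → ⊢ᵃ Γ ++ Δ

module _ {W : Set} where

  infix 2 ⊩_

  -- A derivation made of sextuples only, with all its cuts, counts as a single leaf. Every
  -- constructor absorbs a permutation of its conclusion, so exchange need not be treated as a rule.
  data ⊩_ : Sequent W → Set₁ where
    atoms : ∀ {Θ Γ} → ⊢ᵃ Θ → Γ ↭ map atomic Θ → ⊩ Γ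
    ◇-introᶜ : ∀ {φ ψ Γ Π} → ⊩ φ ∷ Γ → ⊩ ψ ∷ Γ → Π ↭ φ ◇ ψ ∷ Γ → ⊩ Π
    ⟷-introᶜ : ∀ {φ ψ Γ Δ Π} → ⊩ φ ∷ Γ → ⊩ ψ ∷ Δ → Π ↭ φ ⟷ ψ ∷ Γ ++ Δ → ⊩ Π

  ⊩-resp-↭ : ∀ {Γ Δ} → Γ ↭ Δ → ⊩ Γ → ⊩ Δ
  ⊩-resp-↭ p (atoms d q)        = atoms d (↭-trans (↭-sym p) q)
  ⊩-resp-↭ p (◇-introᶜ d e q) = ◇-introᶜ d e (↭-trans (↭-sym p) q)
  ⊩-resp-↭ p (⟷-introᶜ d e q) = ⟷-introᶜ d e (↭-trans (↭-sym p) q)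

  data Principal : Formula W → Sequent W → Set₁ where
    atomᵖ : ∀ {α Θ Γ} → ⊢ᵃ α ∷ Θ → Γ ↭ map atomic Θ → Principal (atomic α) Γ
    ◇ᵖ : ∀ {φ ψ Γ} → ⊩ φ ∷ Γ → ⊩ ψ ∷ Γ → Principal (φ ◇ ψ) Γ
    ⟷ᵖ : ∀ {φ ψ Γ Δ Π} → ⊩ φ ∷ Γ → ⊩ ψ ∷ Δ → Π ↭ Γ ++ Δ → Principal (φ ⟷ ψ) Π

  ++-swapʳ : ∀ {A : Set} (xs ys zs : List A) → (xs ++ ys) ++ zs ↭ (xs ++ zs) ++ ys
  ++-swapʳ xs ys zs =
    ↭-trans (++-assoc xs ys zs)
      (↭-trans (++⁺ˡ xs (++-comm ys zs)) (↭-sym (++-assoc xs zs ys)))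

  module _ {φ : Formula W} {Δ : Sequent W} (principal : ∀ {Γ} → Principal φ Γ → ⊩ Γ ++ Δ) where

    -- A rule that φ is not the principal formula of is permuted below.
    descend : ∀ {Π Γ} → ⊩ Π → Π ↭ φ ∷ Γ → ⊩ Γ ++ Δ
    descend (atoms {Θ} d p) q
      with Θ′ , eq , r ← ↭-map-inv atomic (↭-trans (↭-sym p) q)
      with α ∷ Θ″ ← Θ′
      with refl , refl ← ∷-injective eq = principal (atomᵖ (exchangeᵃ r d) ↭-refl)
    descend {Γ = Γ} (◇-introᶜ {χ} {θ} {Γ₁} d e p) q with ∷↭∷-inv (↭-trans (↭-sym q) p)
    ... | inj₁ (refl , r) = principal (◇ᵖ (⊩-resp-↭ (prep _ (↭-sym r)) d) (⊩-resp-↭ (prep _ (↭-sym r)) e))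
    ... | inj₂ (Γ₂ , r , s) =
      ◇-introᶜ (descend d (under s)) (descend e (under s)) (++⁺ʳ Δ r)
      where
      under : ∀ {χ} → Γ₁ ↭ φ ∷ Γ₂ → χ ∷ Γ₁ ↭ φ ∷ χ ∷ Γ₂
      under s = ↭-trans (prep _ s) (↭.swap _ _ ↭-refl)
    descend {Γ = Γ} (⟷-introᶜ {χ} {θ} {Γ₁} {Γ₂} d e p) q with ∷↭∷-inv (↭-trans (↭-sym q) p)
    ... | inj₁ (refl , r) = principal (⟷ᵖ d e r)
    ... | inj₂ (Γ₃ , r , s) with ∷↭++-inv Γ₁ (↭-sym s)
    ...   | inj₁ (Γ₁′ , t , u) =
      ⟷-introᶜ (descend d (↭-trans (prep _ t) (↭.swap _ _ ↭-refl))) e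
        (↭-trans (++⁺ʳ Δ r) (prep _ (↭-trans (++⁺ʳ Δ u) (++-swapʳ Γ₁′ Γ₂ Δ))))
    ...   | inj₂ (Γ₂′ , t , u) =
      ⟷-introᶜ d (descend e (↭-trans (prep _ t) (↭.swap _ _ ↭-refl)))
        (↭-trans (++⁺ʳ Δ r) (prep _ (↭-trans (++⁺ʳ Δ u) (++-assoc Γ₁ Γ₂′ Δ))))

  ⊩-empty-cut-atoms : ∀ {Θ Δ} → ⊢ᵃ Θ → ⊩ Δ → ⊩ map atomic Θ ++ Δ
  ⊩-empty-cut-atoms {Θ} d (atoms {Θ′} d′ p) =
    atoms (empty-cutᵃ d d′) (↭-trans (++⁺ˡ (map atomic Θ) p) (↭-reflexive (sym (map-++ atomic Θ Θ′))))
  ⊩-empty-cut-atoms {Θ} d (◇-introᶜ e f p) =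
    ◇-introᶜ (⊩-resp-↭ (shift _ (map atomic Θ) _) (⊩-empty-cut-atoms d e))
             (⊩-resp-↭ (shift _ (map atomic Θ) _) (⊩-empty-cut-atoms d f))
             (↭-trans (++⁺ˡ (map atomic Θ) p) (shift _ (map atomic Θ) _))
  ⊩-empty-cut-atoms {Θ} d (⟷-introᶜ {Γ = Γ₁} {Δ = Γ₂} e f p) =
    ⟷-introᶜ (⊩-resp-↭ (shift _ (map atomic Θ) _) (⊩-empty-cut-atoms d e)) f
             (↭-trans (++⁺ˡ (map atomic Θ) p)
               (↭-trans (shift _ (map atomic Θ) _) (prep _ (↭-sym (++-assoc (map atomic Θ) Γ₁ Γ₂)))))

  ⊩-empty-cut : ∀ {Γ Δ} → ⊩ Γ → ⊩ Δ → ⊩ Γ ++ Δ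
  ⊩-empty-cut {Δ = Δ} (atoms d p) e = ⊩-resp-↭ (++⁺ʳ Δ (↭-sym p)) (⊩-empty-cut-atoms d e)
  ⊩-empty-cut {Δ = Δ} (◇-introᶜ d d′ p) e =
    ◇-introᶜ (⊩-empty-cut d e) (⊩-empty-cut d′ e) (++⁺ʳ Δ p)
  ⊩-empty-cut {Δ = Δ} (⟷-introᶜ {Γ = Γ₁} {Δ = Γ₂} d d′ p) e =
    ⟷-introᶜ (⊩-empty-cut d e) d′ (↭-trans (++⁺ʳ Δ p) (prep _ (++-swapʳ Γ₁ Γ₂ Δ)))

  mutual

    -- The left derivation is followed until `φ` is principal in it, then the right one. Termination
    -- is by the cut formula, as the principal case calls back only for its components.
    ⊩-cut : ∀ φ {Γ Δ} → ⊩ φ ∷ Γ → ⊩ φ ∷ Δ → ⊩ Γ ++ Δ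
    ⊩-cut φ {Γ} {Δ} d e =
      descend (λ {Γ′} d′ → ⊩-resp-↭ (++-comm Δ Γ′)
        (descend (λ {Δ′} e′ → ⊩-resp-↭ (++-comm Γ′ Δ′) (⊩-cut-principal φ d′ e′)) e ↭-refl)) d ↭-refl

    -- For `◇` each premise carries the full context, so cutting one component is enough. For `⟷`
    -- the context is split, so both components are cut and the results joined; this is where empty
    -- cuts are indispensable.
    ⊩-cut-principal : ∀ φ {Γ Δ} → Principal φ Γ → Principal φ Δ → ⊩ Γ ++ Δ
    ⊩-cut-principal (atomic _) (atomᵖ {Θ = Θ} d p) (atomᵖ {Θ = Θ′} e q) =
      atoms (cutᵃ d e) (↭-trans (++⁺ p q) (↭-reflexive (sym (map-++ atomic Θ Θ′))))
    ⊩-cut-principal (φ ◇ ψ) (◇ᵖ d _) (◇ᵖ e _) = ⊩-cut φ d e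
    ⊩-cut-principal (φ ⟷ ψ) (⟷ᵖ {Γ = Γ} {Γ′} d d′ p) (⟷ᵖ {Γ = Δ} {Δ′} e e′ q) =
      ⊩-resp-↭ (↭-trans interchange (↭-sym (++⁺ p q)))
        (⊩-empty-cut (⊩-cut φ d e) (⊩-cut ψ d′ e′))
      where
      interchange : (Γ ++ Δ) ++ Γ′ ++ Δ′ ↭ (Γ ++ Γ′) ++ Δ ++ Δ′
      interchange =
        ↭-trans (↭-sym (++-assoc (Γ ++ Δ) Γ′ Δ′))
          (↭-trans (++⁺ʳ Δ′ (++-swapʳ Γ Δ Γ′)) (++-assoc (Γ ++ Γ′) Δ Δ′))

  ⊢⇒⊩ : ∀ {Γ} → ⊢ Γ → ⊩ Γ
  ⊢⇒⊩ (complex M ι xs enum uniq) =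
    atoms (complexᵃ M ι xs enum uniq) (↭-reflexive (map-∘ xs))
  ⊢⇒⊩ (rotate δ)      = atoms (rotateᵃ δ) ↭-refl
  ⊢⇒⊩ (switch δ)      = atoms (switchᵃ δ) ↭-refl
  ⊢⇒⊩ (exchange p d)  = ⊩-resp-↭ p (⊢⇒⊩ d)
  ⊢⇒⊩ (cut d e)       = ⊩-cut _ (⊢⇒⊩ d) (⊢⇒⊩ e)
  ⊢⇒⊩ (empty-cut d e) = ⊩-empty-cut (⊢⇒⊩ d) (⊢⇒⊩ e)
  ⊢⇒⊩ (◇-intro d e)   = ◇-introᶜ (⊢⇒⊩ d) (⊢⇒⊩ e) ↭-refl
  ⊢⇒⊩ (⟷-intro d e)   = ⟷-introᶜ (⊢⇒⊩ d) (⊢⇒⊩ e) ↭-refl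

  ⊢ᵃ⇒⊢ : ∀ {Θ : List (Sextuple W)} → ⊢ᵃ Θ → ⊢ map atomic Θ
  ⊢ᵃ⇒⊢ (complexᵃ M ι xs enum uniq) = subst ⊢_ (map-∘ xs) (complex M ι xs enum uniq)
  ⊢ᵃ⇒⊢ (rotateᵃ δ) = rotate δ
  ⊢ᵃ⇒⊢ (switchᵃ δ) = switch δ
  ⊢ᵃ⇒⊢ (exchangeᵃ p d) = exchange (map⁺ atomic p) (⊢ᵃ⇒⊢ d)
  ⊢ᵃ⇒⊢ (cutᵃ {Γ} {Δ} d e) = subst ⊢_ (sym (map-++ atomic Γ Δ)) (cut (⊢ᵃ⇒⊢ d) (⊢ᵃ⇒⊢ e))
  ⊢ᵃ⇒⊢ (empty-cutᵃ {Γ} {Δ} d e) = subst ⊢_ (sym (map-++ atomic Γ Δ)) (empty-cut (⊢ᵃ⇒⊢ d) (⊢ᵃ⇒⊢ e))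

  ⊩⇒⊢ : ∀ {Γ} → ⊩ Γ → ⊢ Γ
  ⊩⇒⊢ (atoms d p)        = exchange (↭-sym p) (⊢ᵃ⇒⊢ d)
  ⊩⇒⊢ (◇-introᶜ d e p) = exchange (↭-sym p) (◇-intro (⊩⇒⊢ d) (⊩⇒⊢ e))
  ⊩⇒⊢ (⟷-introᶜ d e p) = exchange (↭-sym p) (⟷-intro (⊩⇒⊢ d) (⊩⇒⊢ e))

  -- Backward search through compound formulae

  connectives : Formula W → ℕ
  connectives (atomic _) = 0
  connectives (φ ◇ ψ) = suc (connectives φ ℕ.+ connectives ψ)
  connectives (φ ⟷ ψ) = suc (connectives φ ℕ.+ connectives ψ)

  -- Counting connectives is a measure for both rules: although `◇` copies the context, each single
  -- premise contains it once and lacks one connective.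
  size : Sequent W → ℕ
  size Γ = sum (map connectives Γ)

  size-↭ : ∀ {Γ Δ} → Γ ↭ Δ → size Γ ≡ size Δ
  size-↭ p = sum-↭ (map⁺ connectives p)

  size-++ : ∀ Γ Δ → size (Γ ++ Δ) ≡ size Γ ℕ.+ size Δ
  size-++ Γ Δ = trans (cong sum (map-++ connectives Γ Δ)) (sum-++ (map connectives Γ) _)

  private
    shrink : ∀ {k} a b c {c′} → c ℕ.≤ c′ → k ≡ suc (a ℕ.+ b) ℕ.+ c′ → a ℕ.+ c ℕ.< k × b ℕ.+ c ℕ.< k
    shrink a b c c≤c′ refl =
      s≤s (ℕ.+-mono-≤ (ℕ.m≤m+n a b) c≤c′) , s≤s (ℕ.+-mono-≤ (ℕ.m≤n+m b a) c≤c′)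

  atomic-sequent? : (Γ : Sequent W) → Dec (∃ λ Θ → Γ ≡ map atomic Θ)
  atomic-sequent? [] = yes ([] , refl)
  atomic-sequent? (atomic α ∷ Γ) =
    map′ (λ (Θ , eq) → α ∷ Θ , cong (_ ∷_) eq)
         (λ { (_ ∷ Θ , eq) → Θ , proj₂ (∷-injective eq) }) (atomic-sequent? Γ)
  atomic-sequent? (_ ◇ _ ∷ _) = no λ { ([] , ()) ; (_ ∷ _ , ()) }
  atomic-sequent? (_ ⟷ _ ∷ _) = no λ { ([] , ()) ; (_ ∷ _ , ()) }

  Introduced : Formula W → Sequent W → Set₁
  Introduced (atomic _) Γ = Lift _ ⊥
  Introduced (φ ◇ ψ) Γ = (⊩ φ ∷ Γ) × (⊩ ψ ∷ Γ)
  Introduced (φ ⟷ ψ) Γ = ∃₂ λ Γ₁ Γ₂ → Γ ↭ Γ₁ ++ Γ₂ × (⊩ φ ∷ Γ₁) × (⊩ ψ ∷ Γ₂)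

  Introduced-resp-↭ : ∀ φ {Γ Δ} → Γ ↭ Δ → Introduced φ Γ → Introduced φ Δ
  Introduced-resp-↭ (φ ◇ ψ) p (d , e) = ⊩-resp-↭ (prep _ p) d , ⊩-resp-↭ (prep _ p) e
  Introduced-resp-↭ (φ ⟷ ψ) p (Γ₁ , Γ₂ , q , d , e) = Γ₁ , Γ₂ , ↭-trans (↭-sym p) q , d , e

  Introduced⇒⊩ : ∀ φ {Γ Π} → Π ↭ φ ∷ Γ → Introduced φ Γ → ⊩ Π
  Introduced⇒⊩ (φ ◇ ψ) p (d , e) = ◇-introᶜ d e p
  Introduced⇒⊩ (φ ⟷ ψ) p (Γ₁ , Γ₂ , q , d , e) = ⟷-introᶜ d e (↭-trans p (prep _ q))

  module _ (⊢ᵃ? : (Θ : List (Sextuple W)) → Dec (⊢ᵃ Θ)) where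

    ⊩?-acc : ∀ Γ → Acc ℕ._<_ (size Γ) → Dec (⊩ Γ)
    ⊩?-acc Γ (acc rec) = map′ to from (atoms? ⊎-dec any-pick? Γ (Introduced-resp-↭ _) introduced?)
      where
      Last : Set₁
      Last = (∃ λ Θ → Γ ↭ map atomic Θ × (⊢ᵃ Θ)) ⊎ (∃₂ λ φ Δ → Γ ↭ φ ∷ Δ × Introduced φ Δ)

      to : Last → ⊩ Γ
      to (inj₁ (Θ , p , d)) = atoms d p
      to (inj₂ (φ , Δ , p , d)) = Introduced⇒⊩ φ p d

      from : ⊩ Γ → Last
      from (atoms d p) = inj₁ (_ , p , d)
      from (◇-introᶜ d e p) = inj₂ (_ , _ , p , d , e)
      from (⟷-introᶜ d e p) = inj₂ (_ , _ , p , _ , _ , ↭-refl , d , e)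

      atoms? : Dec (∃ λ Θ → Γ ↭ map atomic Θ × (⊢ᵃ Θ))
      atoms? with atomic-sequent? Γ
      ... | yes (Θ , refl) =
        map′ (λ d → Θ , ↭-refl , d)
             (λ (Θ′ , p , d) → exchangeᵃ (reflect p) d) (⊢ᵃ? Θ)
        where
        reflect : ∀ {Θ′} → map atomic Θ ↭ map atomic Θ′ → Θ′ ↭ Θ
        reflect p with _ , eq , q ← ↭-map-inv atomic p =
          ↭-sym (subst (Θ ↭_) (sym (map-injective (λ { refl → refl }) eq)) q)
      ... | no ¬atomic = no λ (Θ , p , _) →
        let _ , eq , _ = ↭-map-inv atomic (↭-sym p) in ¬atomic (_ , eq)

      introduced? : ∀ φ Δ → Γ ↭ φ ∷ Δ → Dec (Introduced φ Δ)
      introduced? (atomic _) Δ p = no λ ()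
      introduced? (φ ◇ ψ) Δ p =
        ⊩?-acc (φ ∷ Δ) (rec (proj₁ smaller)) ×-dec ⊩?-acc (ψ ∷ Δ) (rec (proj₂ smaller))
        where smaller = shrink (connectives φ) (connectives ψ) (size Δ) ℕ.≤-refl (size-↭ p)
      introduced? (φ ⟷ ψ) Δ p =
        any-split? Δ (λ q r (d , e) → ⊩-resp-↭ (prep _ q) d , ⊩-resp-↭ (prep _ r) e) λ Γ₁ Γ₂ q →
          let eq = trans (size-↭ q) (size-++ Γ₁ Γ₂)
              a = connectives φ
              b = connectives ψ in
          ⊩?-acc (φ ∷ Γ₁) (rec (proj₁ (shrink a b (size Γ₁)
            (ℕ.≤-trans (ℕ.m≤m+n _ (size Γ₂)) (ℕ.≤-reflexive (sym eq))) (size-↭ p))))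
          ×-dec
          ⊩?-acc (ψ ∷ Γ₂) (rec (proj₂ (shrink a b (size Γ₂)
            (ℕ.≤-trans (ℕ.m≤n+m _ (size Γ₁)) (ℕ.≤-reflexive (sym eq))) (size-↭ p))))

    ⊢? : ∀ Γ → Dec (⊢ Γ)
    ⊢? Γ = map′ ⊩⇒⊢ ⊢⇒⊩ (⊩?-acc Γ (<-wellFounded (size Γ)))

-- Coefficients in free abelian groups

eval : ∀ {X : Set} → (X → ℤ) → Expr X → ℤ
eval = extend ℤ.+-0-abelianGroup

eval-cong : ∀ {X : Set} (g : X → ℤ) {a b} → a ≋ b → eval g a ≡ eval g b
eval-cong = extend-cong ℤ.+-0-abelianGroup

eval-extend : ∀ {X Y : Set} (g : Y → ℤ) (f : X → Expr Y) c →
              eval g (extend (freeAbelianGroup Y) f c) ≡ eval (eval g ∘ f) c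
eval-extend g f (gen x) = refl
eval-extend g f 0#      = refl
eval-extend g f (a ⊕ b) = cong₂ _+_ (eval-extend g f a) (eval-extend g f b)
eval-extend g f (⊖ a)   = cong -_ (eval-extend g f a)

module Coefficients {X : Set} (_≟_ : DecidableEquality X) where

  δ : X → X → ℤ
  δ y x with y ≟ x
  ... | yes _ = 1ℤ
  ... | no _  = 0ℤ

  δ-refl : ∀ x → δ x x ≡ 1ℤ
  δ-refl x with x ≟ x
  ... | yes _  = refl
  ... | no x≢x = contradiction refl x≢x

  δ-≢ : ∀ {x y} → x ≢ y → δ x y ≡ 0ℤ
  δ-≢ {x} {y} x≢y with x ≟ y
  ... | yes x≡y = contradiction x≡y x≢y
  ... | no _    = refl

  δ≥0 : ∀ x y → 0ℤ ≤ δ x y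
  δ≥0 x y with x ≟ y
  ... | yes _ = +≤+ z≤n
  ... | no _  = +≤+ z≤n

  coeff : X → Expr X → ℤ
  coeff y = eval (δ y)

  -- Meant for the incidence numbers of one edge: it lies on two triangles only, so its coefficient
  -- in a boundary has two terms.
  eval-two : ∀ (g : X → ℤ) {u v} → u ≢ v → (∀ t → t ≢ u → t ≢ v → g t ≡ 0ℤ) →
             ∀ c → eval g c ≡ g u * coeff u c + g v * coeff v c
  eval-two g {u} {v} u≢v off = go
    where
    zeros : ∀ a b → 0ℤ ≡ a * 0ℤ + b * 0ℤ
    zeros = solve-∀
    left : ∀ a b → a ≡ a * 1ℤ + b * 0ℤ
    left = solve-∀
    right : ∀ a b → b ≡ a * 0ℤ + b * 1ℤ
    right = solve-∀
    plus : ∀ a b p q r s → (a * p + b * q) + (a * r + b * s) ≡ a * (p + r) + b * (q + s)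
    plus = solve-∀
    minus : ∀ a b p q → - (a * p + b * q) ≡ a * (- p) + b * (- q)
    minus = solve-∀
    go : ∀ c → eval g c ≡ g u * coeff u c + g v * coeff v c
    go (gen x) with u ≟ x | v ≟ x
    ... | yes refl | yes refl = contradiction refl u≢v
    ... | yes refl | no _     = left (g u) (g v)
    ... | no _     | yes refl = right (g u) (g v)
    ... | no u≢x   | no v≢x   =
      trans (off x (≢-sym u≢x) (≢-sym v≢x)) (zeros (g u) (g v))
    go 0#      = zeros (g u) (g v)
    go (a ⊕ b) = trans (cong₂ _+_ (go a) (go b)) (plus (g u) (g v) _ _ _ _)
    go (⊖ a)   = trans (cong -_ (go a)) (minus (g u) (g v) _ _)

  private
    module ℤ∙ = AbelianGroupProperties ℤ.+-0-abelianGroup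
    module G = AbelianGroup (freeAbelianGroup X)
    open AbelianGroupProperties (freeAbelianGroup X) using (⁻¹-∙-comm; ⁻¹-involutive; ε⁻¹≈ε)
    open CommutativeSemigroupProperties G.commutativeSemigroup using (interchange; x∙yz≈y∙xz)
    open SetoidReasoning G.setoid

  sumE : List X → Expr X
  sumE = List.foldr (λ x → gen x ⊕_) 0#

  sumE-++ : ∀ ps qs → sumE (ps ++ qs) ≋ sumE ps ⊕ sumE qs
  sumE-++ [] qs       = ≋-sym (identityˡ _)
  sumE-++ (p ∷ ps) qs = ≋-trans (⊕-cong ≋-refl (sumE-++ ps qs)) (≋-sym (assoc _ _ _))

  -- Without minus signs nothing cancels, so sums of generators can be compared through their
  -- coefficients. Every expression is reduced to two such sums.
  difference : ∀ c → ∃₂ λ ps qs → c ≋ sumE ps ⊕ ⊖ sumE qs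
  difference (gen x) = x ∷ [] , [] , (begin
    gen x                    ≈⟨ G.identityʳ _ ⟨
    gen x ⊕ 0#               ≈⟨ G.identityʳ _ ⟨
    gen x ⊕ 0# ⊕ 0#          ≈⟨ ⊕-cong ≋-refl ε⁻¹≈ε ⟨
    gen x ⊕ 0# ⊕ ⊖ 0#        ∎)
  difference 0# = [] , [] , ≋-sym (G.inverseʳ 0#)
  difference (a ⊕ b)
    with ps , qs , p ← difference a
    with rs , ss , q ← difference b = ps ++ rs , qs ++ ss , (begin
      a ⊕ b                                                ≈⟨ ⊕-cong p q ⟩
      (sumE ps ⊕ ⊖ sumE qs) ⊕ (sumE rs ⊕ ⊖ sumE ss)        ≈⟨ interchange _ _ _ _ ⟩
      (sumE ps ⊕ sumE rs) ⊕ (⊖ sumE qs ⊕ ⊖ sumE ss)        ≈⟨ ⊕-cong (≋-sym (sumE-++ ps rs)) (⁻¹-∙-comm _ _) ⟩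
      sumE (ps ++ rs) ⊕ ⊖ (sumE qs ⊕ sumE ss)              ≈⟨ ⊕-cong ≋-refl (⊖-cong (sumE-++ qs ss)) ⟨
      sumE (ps ++ rs) ⊕ ⊖ sumE (qs ++ ss)                  ∎)
  difference (⊖ a) with ps , qs , p ← difference a = qs , ps , (begin
      ⊖ a                          ≈⟨ ⊖-cong p ⟩
      ⊖ (sumE ps ⊕ ⊖ sumE qs)      ≈⟨ ⁻¹-∙-comm _ _ ⟨
      ⊖ sumE ps ⊕ ⊖ ⊖ sumE qs      ≈⟨ ⊕-cong ≋-refl (⁻¹-involutive _) ⟩
      ⊖ sumE ps ⊕ sumE qs          ≈⟨ comm _ _ ⟩
      sumE qs ⊕ ⊖ sumE ps          ∎)

  coeff-sumE≥0 : ∀ y ps → 0ℤ ≤ coeff y (sumE ps)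
  coeff-sumE≥0 y []       = +≤+ z≤n
  coeff-sumE≥0 y (p ∷ ps) = ℤ.+-mono-≤ (δ≥0 y p) (coeff-sumE≥0 y ps)

  coeff-head≢0 : ∀ y ps → coeff y (sumE (y ∷ ps)) ≢ 0ℤ
  coeff-head≢0 y ps eq = contradiction (begin-≤ ) λ { (+≤+ ()) }
    where
    begin-≤ : 1ℤ ≤ 0ℤ
    begin-≤ = subst₂ _≤_ refl eq
      (ℤ.+-mono-≤ {1ℤ} {δ y y} {0ℤ} (ℤ.≤-reflexive (sym (δ-refl y))) (coeff-sumE≥0 y ps))

  coeff-∉ : ∀ {y} ps → y ∉ ps → coeff y (sumE ps) ≡ 0ℤ
  coeff-∉ []       y∉ = refl
  coeff-∉ (p ∷ ps) y∉ = cong₂ _+_ (δ-≢ (y∉ ∘ here)) (coeff-∉ ps (y∉ ∘ there))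

  sumE-extract : ∀ {y ps} → y ∈ ps → ∃ λ qs → sumE ps ≋ sumE (y ∷ qs)
  sumE-extract {ps = _ ∷ ps} (here refl) = ps , ≋-refl
  sumE-extract {ps = p ∷ _} (there y∈ps) with qs , eq ← sumE-extract y∈ps =
    p ∷ qs , ≋-trans (⊕-cong ≋-refl eq) (x∙yz≈y∙xz _ _ _)

  -- The head of `ps` has a positive coefficient, hence occurs in `qs` as well, and is cancelled on
  -- both sides.
  sumE-injective : ∀ ps qs → (∀ y → coeff y (sumE ps) ≡ coeff y (sumE qs)) → sumE ps ≋ sumE qs
  sumE-injective [] [] eq = ≋-refl
  sumE-injective [] (q ∷ qs) eq = contradiction (sym (eq q)) (coeff-head≢0 q qs)
  sumE-injective (p ∷ ps) qs eq with p ∈? qs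
    where open DecMembership _≟_ using (_∈?_)
  ... | no p∉qs = contradiction (trans (eq p) (coeff-∉ qs p∉qs)) (coeff-head≢0 p ps)
  ... | yes p∈qs with rs , split ← sumE-extract p∈qs =
    ≋-trans (⊕-cong ≋-refl (sumE-injective ps rs λ y →
      ℤ∙.∙-cancelˡ (δ y p) _ _ (trans (eq y) (eval-cong (δ y) split)))) (≋-sym split)

  coeff-zero : ∀ c → (∀ y → coeff y c ≡ 0ℤ) → c ≋ 0#
  coeff-zero c eq with ps , qs , p ← difference c = begin
    c                        ≈⟨ p ⟩
    sumE ps ⊕ ⊖ sumE qs      ≈⟨ ⊕-cong (sumE-injective ps qs λ y →
                                  ℤ.i-j≡0⇒i≡j _ _ (trans (sym (eval-cong (δ y) p)) (eq y))) ≋-refl ⟩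
    sumE qs ⊕ ⊖ sumE qs      ≈⟨ G.inverseʳ _ ⟩
    0#                       ∎

  coeff-injective : ∀ a b → (∀ y → coeff y a ≡ coeff y b) → a ≋ b
  coeff-injective a b eq = begin
    a               ≈⟨ G.identityʳ a ⟨
    a ⊕ 0#          ≈⟨ ⊕-cong ≋-refl (inverseˡ b) ⟨
    a ⊕ (⊖ b ⊕ b)   ≈⟨ assoc _ _ _ ⟨
    a ⊕ ⊖ b ⊕ b     ≈⟨ ⊕-cong (coeff-zero (a ⊕ ⊖ b) λ y → ℤ.i≡j⇒i-j≡0 (eq y)) ≋-refl ⟩
    0# ⊕ b          ≈⟨ identityˡ b ⟩
    b               ∎

-- Oriented surfaces and 2-cycles

parity : ℕ → ℤ
parity zero    = 1ℤ
parity (suc n) = - parity n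

parity² : ∀ n → parity n * parity n ≡ 1ℤ
parity² zero    = refl
parity² (suc n) = trans (neg² (parity n)) (parity² n)
  where
  neg² : ∀ a → - a * - a ≡ a * a
  neg² = solve-∀

∣parity∣ : ∀ n → ∣ parity n ∣ ≡ 1
∣parity∣ zero    = refl
∣parity∣ (suc n) = trans (ℤ.∣-i∣≡∣i∣ (parity n)) (∣parity∣ n)

parity-cancel : ∀ n {a b} → parity n * a ≡ parity n * b → a ≡ b
parity-cancel n {a} {b} eq = trans (sym (back a)) (trans (cong (parity n *_) eq) (back b))
  where
  back : ∀ a → parity n * (parity n * a) ≡ a
  back a = trans (sym (ℤ.*-assoc (parity n) (parity n) a))
             (trans (cong (_* a) (parity² n)) (ℤ.*-identityˡ a))

-- Signs are coded in `Fin 2`, so that the choices of a sign for every triangle form a finite set;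
-- `parity ∘ toℕ` decodes them.
sign-code : ℤ → Fin 2
sign-code (+ _)    = zero
sign-code -[1+ _ ] = suc zero

parity-sign-code : ∀ i → i ≡ parity (toℕ (sign-code i)) * + ∣ i ∣
parity-sign-code (+ n)    = sym (ℤ.*-identityˡ (+ n))
parity-sign-code -[1+ n ] = cong -[1+_] (sym (ℕ.+-identityʳ n))

sum≡0⇒≡- : ∀ a b → a + b ≡ 0ℤ → a ≡ - b
sum≡0⇒≡- a b eq = ℤ.i-j≡0⇒i≡j a (- b) (trans (cong (_+_ a) (ℤ.neg-involutive b)) eq)

module Incidence {V E T : Set} (d¹ : Fin 2 → E → V) (d² : Fin 3 → T → E) where

  _EdgeOf_ : E → T → Set
  e EdgeOf u = ∃ λ i → d² i u ≡ e

  _EndOf_ : V → E → Set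
  w EndOf e = ∃ λ i → d¹ i e ≡ w

  _VertexOf_ : V → T → Set
  w VertexOf u = ∃ λ e → e EdgeOf u × w EndOf e

  Adjacent : V → V → Set
  Adjacent v w = ∃ λ e → (d¹ zero e ≡ v × d¹ (suc zero) e ≡ w)
                       ⊎ (d¹ zero e ≡ w × d¹ (suc zero) e ≡ v)

  Neighbours : V → T → T → Set
  Neighbours w u v = ∃ λ e → e EdgeOf u × e EdgeOf v × w EndOf e

  -- The equation says that the chain with coefficients given by the signs `side` has boundary zero
  -- at an edge shared by `u` and `v`.
  Consistent : (T → Fin 2) → Set
  Consistent side = ∀ u v i j → u ≢ v → d² i u ≡ d² j v →
    parity (toℕ i) * parity (toℕ (side u)) + parity (toℕ j) * parity (toℕ (side v)) ≡ 0ℤ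

  -- The conditions on an M-complex that concern only faces in dimensions 0 to 2, with the
  -- simplicial identities written out. Finiteness and the homology condition are left aside, so
  -- that the rest can be moved along bijections and checked on tables.
  record IsPseudosurface : Set where
    field
      d₀e₁            : ∀ x → d¹ zero (d² (suc zero) x) ≡ d¹ zero (d² zero x)
      d₀e₂            : ∀ x → d¹ zero (d² (suc (suc zero)) x) ≡ d¹ (suc zero) (d² zero x)
      d₁e₂            : ∀ x → d¹ (suc zero) (d² (suc (suc zero)) x) ≡ d¹ (suc zero) (d² (suc zero) x)
      connected       : ∀ v w → v ≢ w → Star Adjacent v w
      vertex-face     : ∀ w → ∃ λ e → w EndOf e
      edge-face       : ∀ e → ∃ λ u → e EdgeOf u
      edges-differ    : ∀ u i j → i ≢ j → d² i u ≢ d² j u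
      vertices-differ : ∀ e i j → i ≢ j → d¹ i e ≢ d¹ j e
      two-sided       : ∀ e → ∃ λ u → ∃ λ v →
                        u ≢ v × e EdgeOf u × e EdgeOf v ×
                        (∀ t → e EdgeOf t → t ≡ u ⊎ t ≡ v)
      link-connected  : ∀ w u v → w VertexOf u → w VertexOf v → Star (Neighbours w) u v

  -- The combinatorial substitute for `H₂≅ℤ`. The triangle excludes the empty complex, which meets
  -- the other conditions vacuously but has trivial second homology.
  record IsOrientedSurface : Set where
    field
      isPseudosurface : IsPseudosurface
      inhabitant      : T
      orientation     : ∃ Consistent

    open IsPseudosurface isPseudosurface public

module Chains {V E T : Set} (d¹ : Fin 2 → E → V) (d² : Fin 3 → T → E)
  (_≟V_ : DecidableEquality V) (_≟E_ : DecidableEquality E) (_≟T_ : DecidableEquality T) where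

  open Incidence d¹ d²
  private
    module CE = Coefficients _≟E_
    module CT = Coefficients _≟T_
  open CE using (δ; δ-refl; δ-≢)

  -- The sum over `Fin 3` in the boundary map of `Complex`, unfolded so that the two boundary maps
  -- agree by computation.
  ∂gen : T → Expr E
  ∂gen x = gen (d² zero x) ⊕ (⊖ gen (d² (suc zero) x) ⊕ (⊖ ⊖ gen (d² (suc (suc zero)) x) ⊕ 0#))

  ∂ : Expr T → Expr E
  ∂ = extend (freeAbelianGroup E) ∂gen

  module _ (S : IsPseudosurface) where

    open IsPseudosurface S

    -- Two different triangles at an edge exhaust the two that `two-sided` allows.
    sides : ∀ {u v i j} → u ≢ v → d² i u ≡ d² j v → ∀ t → d² i u EdgeOf t → t ≡ u ⊎ t ≡ v
    sides {u} {v} {i} {j} u≢v eq t e∈t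
      with x , y , _ , _ , _ , only ← two-sided (d² i u)
      with only u (i , refl) | only v (j , sym eq) | only t e∈t
    ... | inj₁ refl | _         | inj₁ t≡u = inj₁ t≡u
    ... | inj₂ refl | _         | inj₂ t≡u = inj₁ t≡u
    ... | inj₁ refl | inj₁ refl | inj₂ _   = contradiction refl u≢v
    ... | inj₁ refl | inj₂ refl | inj₂ t≡v = inj₂ t≡v
    ... | inj₂ refl | inj₁ refl | inj₁ t≡v = inj₂ t≡v
    ... | inj₂ refl | inj₂ refl | inj₁ _   = contradiction refl u≢v

    -- Paths of vertices lift to paths of triangles because links are connected.
    constant : ∀ {A : Set} (F : T → A) →
               (∀ u v i j → u ≢ v → d² i u ≡ d² j v → F u ≡ F v) → ∀ u v → F u ≡ F v
    constant F step u v = between u v (vertexOf u) (vertexOf v)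
      where
      corner : T → V
      corner u = d¹ zero (d² zero u)

      vertexOf : ∀ u → corner u VertexOf u
      vertexOf u = _ , (zero , refl) , zero , refl

      neighbours : ∀ {w u v} → Neighbours w u v → F u ≡ F v
      neighbours {u = u} {v} (e , (i , p) , (j , q) , _) with u ≟T v
      ... | yes refl = refl
      ... | no u≢v   = step u v i j u≢v (trans p (sym q))

      link : ∀ {w u v} → w VertexOf u → w VertexOf v → F u ≡ F v
      link p q = go (link-connected _ _ _ p q)
        where
        go : ∀ {w u v} → Star (Neighbours w) u v → F u ≡ F v
        go ε        = refl
        go (n ◅ ns) = trans (neighbours n) (go ns)

      along : ∀ {w w′ u v} → Star Adjacent w w′ → w VertexOf u → w′ VertexOf v → F u ≡ F v
      along ε p q = link p q
      along ((e , ends) ◅ path) p q with t , e∈t ← edge-face e with ends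
      ... | inj₁ (w₀ , w₁) = trans (link p (e , e∈t , zero , w₀)) (along path (e , e∈t , suc zero , w₁) q)
      ... | inj₂ (w₀ , w₁) = trans (link p (e , e∈t , suc zero , w₁)) (along path (e , e∈t , zero , w₀) q)

      between : ∀ {w w′} u v → w VertexOf u → w′ VertexOf v → F u ≡ F v
      between {w} {w′} u v p q with w ≟V w′
      ... | yes refl = link p q
      ... | no w≢w′  = along (connected w w′ w≢w′) p q

    incidence : E → T → ℤ
    incidence e x = eval (δ e) (∂gen x)

    -- The three edges of a triangle differ, so exactly one term of its boundary survives.
    incidence-edge : ∀ i x → incidence (d² i x) x ≡ parity (toℕ i)
    incidence-edge zero x
      rewrite δ-refl (d² zero x)
            | δ-≢ (edges-differ x zero (suc zero) λ ())
            | δ-≢ (edges-differ x zero (suc (suc zero)) λ ()) = refl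
    incidence-edge (suc zero) x
      rewrite δ-refl (d² (suc zero) x)
            | δ-≢ (edges-differ x (suc zero) zero λ ())
            | δ-≢ (edges-differ x (suc zero) (suc (suc zero)) λ ()) = refl
    incidence-edge (suc (suc zero)) x
      rewrite δ-refl (d² (suc (suc zero)) x)
            | δ-≢ (edges-differ x (suc (suc zero)) zero λ ())
            | δ-≢ (edges-differ x (suc (suc zero)) (suc zero) λ ()) = refl

    incidence-¬edge : ∀ {e x} → ¬ e EdgeOf x → incidence e x ≡ 0ℤ
    incidence-¬edge ¬edge
      rewrite δ-≢ (λ eq → ¬edge (zero , sym eq))
            | δ-≢ (λ eq → ¬edge (suc zero , sym eq))
            | δ-≢ (λ eq → ¬edge (suc (suc zero) , sym eq)) = refl

    coeff-∂ : ∀ {u v i j} → u ≢ v → d² i u ≡ d² j v → ∀ c →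
              CE.coeff (d² i u) (∂ c) ≡ parity (toℕ i) * CT.coeff u c + parity (toℕ j) * CT.coeff v c
    coeff-∂ {u} {v} {i} {j} u≢v eq c = begin
      CE.coeff e (∂ c)             ≡⟨ eval-extend (δ e) ∂gen c ⟩
      eval (incidence e) c         ≡⟨ CT.eval-two (incidence e) u≢v off c ⟩
      incidence e u * CT.coeff u c + incidence e v * CT.coeff v c
        ≡⟨ cong₂ (λ a b → a * CT.coeff u c + b * CT.coeff v c)
                 (incidence-edge i u)
                 (trans (cong (λ e → incidence e v) eq) (incidence-edge j v)) ⟩
      parity (toℕ i) * CT.coeff u c + parity (toℕ j) * CT.coeff v c  ∎
      where
      open ≡-Reasoning
      e = d² i u
      off : ∀ t → t ≢ u → t ≢ v → incidence e t ≡ 0ℤ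
      off t t≢u t≢v = incidence-¬edge ([ t≢u , t≢v ]′ ∘ sides u≢v eq t)

    coeff-cycle : ∀ c → ∂ c ≋ 0# → ∀ u v i j → u ≢ v → d² i u ≡ d² j v →
                  parity (toℕ i) * CT.coeff u c + parity (toℕ j) * CT.coeff v c ≡ 0ℤ
    coeff-cycle c cycle u v i j u≢v eq =
      trans (sym (coeff-∂ u≢v eq c)) (eval-cong (δ (d² i u)) cycle)

    module _ (c : Expr T) (cycle : ∂ c ≋ 0#) where

      private
        absolute : T → ℕ
        absolute u = ∣ CT.coeff u c ∣

        absolute-constant : ∀ u v → absolute u ≡ absolute v
        absolute-constant = constant absolute λ u v i j u≢v eq → begin
          absolute u                               ≡⟨ unit i (CT.coeff u c) ⟨
          ∣ parity (toℕ i) * CT.coeff u c ∣        ≡⟨ cong ∣_∣ (sum≡0⇒≡- (parity (toℕ i) * CT.coeff u c) _ (coeff-cycle c cycle u v i j u≢v eq)) ⟩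
          ∣ - (parity (toℕ j) * CT.coeff v c) ∣    ≡⟨ ℤ.∣-i∣≡∣i∣ (parity (toℕ j) * CT.coeff v c) ⟩
          ∣ parity (toℕ j) * CT.coeff v c ∣        ≡⟨ unit j (CT.coeff v c) ⟩
          absolute v                               ∎
          where
          open ≡-Reasoning
          unit : ∀ {n} (i : Fin n) a → ∣ parity (toℕ i) * a ∣ ≡ ∣ a ∣
          unit i a = trans (ℤ.abs-* (parity (toℕ i)) a)
            (trans (cong (ℕ._* ∣ a ∣) (∣parity∣ (toℕ i))) (ℕ.*-identityˡ _))

      -- The orientation consists of the signs of the coefficients. Their common absolute value `K`
      -- factors out of every edge equation and can be divided away, being nonzero because `c` is.
      cycle⇒orientation : T → ¬ c ≋ 0# → ∃ Consistent
      cycle⇒orientation o c≢0 = side , consistent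
        where
        side : T → Fin 2
        side u = sign-code (CT.coeff u c)

        K = absolute o

        K≢0 : + K ≢ 0ℤ
        K≢0 eq = c≢0 (CT.coeff-zero c λ u →
          ℤ.∣i∣≡0⇒i≡0 (trans (absolute-constant u o) (ℤ.+-injective eq)))

        coeff≡ : ∀ u → CT.coeff u c ≡ parity (toℕ (side u)) * + K
        coeff≡ u = trans (parity-sign-code (CT.coeff u c))
          (cong (λ k → parity (toℕ (side u)) * + k) (absolute-constant u o))

        factor : ∀ a b p q k → a * (p * k) + b * (q * k) ≡ (a * p + b * q) * k
        factor = solve-∀

        consistent : Consistent side
        consistent u v i j u≢v eq =
          [ (λ p → p) , (λ p → contradiction p K≢0) ]′
            (ℤ.i*j≡0⇒i≡0∨j≡0 (parity (toℕ i) * parity (toℕ (side u)) + parity (toℕ j) * parity (toℕ (side v)))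
              (trans (sym (factor (parity (toℕ i)) (parity (toℕ j)) _ _ (+ K)))
                (trans (cong₂ (λ a b → parity (toℕ i) * a + parity (toℕ j) * b) (sym (coeff≡ u)) (sym (coeff≡ v)))
                  (coeff-cycle c cycle u v i j u≢v eq))))

  module _ (S : IsOrientedSurface) where

    open IsOrientedSurface S

    private
      side = proj₁ orientation

      σ : T → ℤ
      σ u = parity (toℕ (side u))

    ∂-zero : ∀ c k → (∀ u → CT.coeff u c ≡ k * σ u) → ∂ c ≋ 0#
    ∂-zero c k eq = CE.coeff-zero (∂ c) vanish
      where
      factor : ∀ a b p q k → a * (k * p) + b * (k * q) ≡ k * (a * p + b * q)
      factor = solve-∀
      vanish : ∀ e → CE.coeff e (∂ c) ≡ 0ℤ
      vanish e with u , v , u≢v , (i , refl) , (j , q) , _ ← two-sided e = begin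
        CE.coeff (d² i u) (∂ c)
          ≡⟨ coeff-∂ isPseudosurface u≢v (sym q) c ⟩
        parity (toℕ i) * CT.coeff u c + parity (toℕ j) * CT.coeff v c
          ≡⟨ cong₂ (λ a b → parity (toℕ i) * a + parity (toℕ j) * b) (eq u) (eq v) ⟩
        parity (toℕ i) * (k * σ u) + parity (toℕ j) * (k * σ v)
          ≡⟨ factor (parity (toℕ i)) (parity (toℕ j)) (σ u) (σ v) k ⟩
        k * (parity (toℕ i) * σ u + parity (toℕ j) * σ v)
          ≡⟨ cong (k *_) (proj₂ orientation u v i j u≢v (sym q)) ⟩
        k * 0ℤ
          ≡⟨ ℤ.*-zeroʳ k ⟩
        0ℤ ∎
        where open ≡-Reasoning

    -- Across an edge the orientation and the coefficient of a cycle change by the same sign, so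
    -- their product stays the same.
    coeff-constant : ∀ c → ∂ c ≋ 0# → ∀ u v → σ u * CT.coeff u c ≡ σ v * CT.coeff v c
    coeff-constant c cycle = constant isPseudosurface _ λ u v i j u≢v eq →
      square (parity (toℕ i)) (parity (toℕ j)) (parity² (toℕ i)) (parity² (toℕ j))
        (sum≡0⇒≡- _ _ (proj₂ orientation u v i j u≢v eq))
        (sum≡0⇒≡- _ _ (coeff-cycle isPseudosurface c cycle u v i j u≢v eq))
      where
      rearrange : ∀ a x y → (a * a) * (x * y) ≡ (a * x) * (a * y)
      rearrange = solve-∀
      negated : ∀ b x y → (- (b * x)) * (- (b * y)) ≡ (b * b) * (x * y)
      negated = solve-∀
      square : ∀ a b {x x′ y y′} → a * a ≡ 1ℤ → b * b ≡ 1ℤ →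
               a * x ≡ - (b * y) → a * x′ ≡ - (b * y′) → x * x′ ≡ y * y′
      square a b {x} {x′} {y} {y′} a² b² p q = begin
        x * x′                       ≡⟨ ℤ.*-identityˡ _ ⟨
        1ℤ * (x * x′)                ≡⟨ cong (_* (x * x′)) a² ⟨
        (a * a) * (x * x′)           ≡⟨ rearrange a x x′ ⟩
        (a * x) * (a * x′)           ≡⟨ cong₂ _*_ p q ⟩
        (- (b * y)) * (- (b * y′))   ≡⟨ negated b y y′ ⟩
        (b * b) * (y * y′)           ≡⟨ cong (_* (y * y′)) b² ⟩
        1ℤ * (y * y′)                ≡⟨ ℤ.*-identityˡ _ ⟩
        y * y′                       ∎
        where open ≡-Reasoning

    -- On cycles this is the isomorphism from the second homology to the integers. By
    -- `coeff-constant` any other triangle would give the same value there.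
    degree : Expr T → ℤ
    degree c = σ inhabitant * CT.coeff inhabitant c

    degree-injective : ∀ a b → ∂ a ≋ 0# → ∂ b ≋ 0# → degree a ≡ degree b → a ≋ b
    degree-injective a b ∂a ∂b eq = CT.coeff-injective a b λ u →
      parity-cancel (toℕ (side u))
        (trans (coeff-constant a ∂a u inhabitant) (trans eq (coeff-constant b ∂b inhabitant u)))

    degree-⊕ : ∀ a b → degree (a ⊕ b) ≡ degree a + degree b
    degree-⊕ a b = ℤ.*-distribˡ-+ (σ inhabitant) (CT.coeff inhabitant a) (CT.coeff inhabitant b)

    degree-⊖ : ∀ a → degree (⊖ a) ≡ - degree a
    degree-⊖ a = sym (ℤ.neg-distribʳ-* (σ inhabitant) (CT.coeff inhabitant a))

    degree-cong : ∀ {a b} → a ≋ b → degree a ≡ degree b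
    degree-cong a≋b = cong (σ inhabitant *_) (eval-cong (CT.δ inhabitant) a≋b)

    degree-0# : degree 0# ≡ 0ℤ
    degree-0# = ℤ.*-zeroʳ (σ inhabitant)

    module _ (xs : List T) (complete : ∀ x → x ∈ xs) (unique : List.Unique xs) where

      private
        signed-gen : T → Fin 2 → Expr T
        signed-gen x zero       = gen x
        signed-gen x (suc zero) = ⊖ gen x

        coeff-signed-gen : ∀ y x s → CT.coeff y (signed-gen x s) ≡ parity (toℕ s) * CT.δ y x
        coeff-signed-gen y x zero       = sym (ℤ.*-identityˡ _)
        coeff-signed-gen y x (suc zero) = sym (ℤ.-1*i≡-i _)

        -- Over a list of all triangles without repetitions this is the fundamental class of the
        -- orientation.
        fundamental : List T → Expr T
        fundamental = List.foldr (λ x → signed-gen x (side x) ⊕_) 0#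

        coeff-fundamental-∉ : ∀ {y} ys → y ∉ ys → CT.coeff y (fundamental ys) ≡ 0ℤ
        coeff-fundamental-∉ [] y∉ = refl
        coeff-fundamental-∉ {y} (x ∷ ys) y∉ =
          cong₂ _+_ (trans (coeff-signed-gen y x (side x))
                      (trans (cong (σ x *_) (CT.δ-≢ (y∉ ∘ here))) (ℤ.*-zeroʳ (σ x))))
                    (coeff-fundamental-∉ ys (y∉ ∘ there))

        coeff-fundamental : ∀ {y ys} → List.Unique ys → y ∈ ys → CT.coeff y (fundamental ys) ≡ σ y
        coeff-fundamental {y} {_ ∷ ys} (y# AllPairs.∷ _) (here refl) =
          trans (cong₂ _+_ (trans (coeff-signed-gen y y (side y))
                             (trans (cong (σ y *_) (CT.δ-refl y)) (ℤ.*-identityʳ (σ y))))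
                           (coeff-fundamental-∉ ys λ y∈ → All.lookup y# y∈ refl))
                (ℤ.+-identityʳ (σ y))
        coeff-fundamental {y} {x ∷ ys} (x# AllPairs.∷ uniq) (there y∈) =
          trans (cong₂ _+_ (trans (coeff-signed-gen y x (side x))
                             (trans (cong (σ x *_) (CT.δ-≢ (≢-sym (All.lookup x# y∈)))) (ℤ.*-zeroʳ (σ x))))
                           (coeff-fundamental uniq y∈))
                (ℤ.+-identityˡ (σ y))

        natural-multiple : ℕ → Expr T → Expr T
        natural-multiple zero    a = 0#
        natural-multiple (suc n) a = a ⊕ natural-multiple n a

        eval-natural-multiple : ∀ g n a → eval g (natural-multiple n a) ≡ + n * eval g a
        eval-natural-multiple g zero a = refl
        eval-natural-multiple g (suc n) a =
          trans (cong (_+_ (eval g a)) (eval-natural-multiple g n a)) (sym (ℤ.suc-* (+ n) (eval g a)))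

        multiple : ℤ → Expr T → Expr T
        multiple (+ n)    a = natural-multiple n a
        multiple -[1+ n ] a = ⊖ natural-multiple (suc n) a

        eval-multiple : ∀ g k a → eval g (multiple k a) ≡ k * eval g a
        eval-multiple g (+ n)    a = eval-natural-multiple g n a
        eval-multiple g -[1+ n ] a = trans (cong -_ (eval-natural-multiple g (suc n) a))
          (ℤ.neg-distribˡ-* (+ suc n) (eval g a))

      cycle : ℤ → Expr T
      cycle k = multiple k (fundamental xs)

      coeff-cycle-multiple : ∀ k u → CT.coeff u (cycle k) ≡ k * σ u
      coeff-cycle-multiple k u =
        trans (eval-multiple (CT.δ u) k (fundamental xs))
              (cong (k *_) (coeff-fundamental unique (complete u)))

      degree-cycle : ∀ k → degree (cycle k) ≡ k
      degree-cycle k = begin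
        s * CT.coeff inhabitant (cycle k)   ≡⟨ cong (s *_) (coeff-cycle-multiple k inhabitant) ⟩
        s * (k * s)                         ≡⟨ rearrange s k ⟩
        k * (s * s)                         ≡⟨ cong (k *_) (parity² (toℕ (side inhabitant))) ⟩
        k * 1ℤ                              ≡⟨ ℤ.*-identityʳ k ⟩
        k                                   ∎
        where
        open ≡-Reasoning
        s = σ inhabitant
        rearrange : ∀ s k → s * (k * s) ≡ k * (s * s)
        rearrange = solve-∀

open Incidence using (IsPseudosurface; IsOrientedSurface)

-- From M-complexes to oriented surfaces

module _ {L : ΔComplex} (M : IsMComplex L) where

  open ΔComplex L
  private module M = IsMComplex M

  mcomplex-isPseudosurface : IsPseudosurface (d 0) (d 1)
  mcomplex-isPseudosurface = record
    { d₀e₁            = d-d 0 zero zero z≤n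
    ; d₀e₂            = d-d 0 zero (suc zero) z≤n
    ; d₁e₂            = d-d 0 (suc zero) (suc zero) (s≤s z≤n)
    ; connected       = M.connected
    ; vertex-face     = M.vertex-face
    ; edge-face       = M.edge-face
    ; edges-differ    = M.edges-differ
    ; vertices-differ = M.vertices-differ
    ; two-sided       = M.two-sided
    ; link-connected  = M.link-connected
    }

  module _ (_≟V_ : DecidableEquality (Cell 0)) (_≟E_ : DecidableEquality (Cell 1))
           (_≟T_ : DecidableEquality (Cell 2)) (xs : List (Cell 2)) (complete : ∀ x → x ∈ xs) where

    open Chains (d 0) (d 1) _≟V_ _≟E_ _≟T_
    open Coefficients _≟T_ using (coeff-zero)
    open GroupMorphisms (Complex.Ker∂ L 1) +-0-rawGroup using (IsGroupIsomorphism)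

    -- The cycle that the isomorphism sends to 1 cannot be zero, so its signs orient the complex.
    mcomplex-isOrientedSurface : IsOrientedSurface (d 0) (d 1)
    mcomplex-isOrientedSurface with f , iso ← M.H₂≅ℤ = record
      { isPseudosurface = mcomplex-isPseudosurface
      ; inhabitant      = triangle
      ; orientation     = cycle⇒orientation mcomplex-isPseudosurface c ∂c triangle c≢0
      }
      where
      module f = IsGroupIsomorphism iso
      generator = f.surjective 1ℤ
      c = proj₁ (proj₁ generator)
      ∂c = proj₂ (proj₁ generator)

      c≢0 : ¬ c ≋ 0#
      c≢0 c≋0 = contradiction
        (trans (sym (proj₂ generator ≋-refl)) (trans (f.⟦⟧-cong {proj₁ generator} {0# , ≋-refl} c≋0) f.ε-homo))
        λ ()

      -- Without triangles all coefficients of `c` would vanish vacuously, and `c` with them.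
      first : ∀ xs → (∀ x → x ∈ xs) → Cell 2
      first []      complete = contradiction (coeff-zero c λ y → contradiction (complete y) λ ()) c≢0
      first (x ∷ _) _        = x

      triangle = first xs complete

-- The primed side is later a table over `Fin`, the unprimed one a given M-complex; properties are
-- carried from the latter to the former.
module Transport {V V′ E E′ T T′ : Set}
  {d¹ : Fin 2 → E → V} {d² : Fin 3 → T → E} {d¹′ : Fin 2 → E′ → V′} {d²′ : Fin 3 → T′ → E′}
  (v↔ : V′ ↔ V) (e↔ : E′ ↔ E) (t↔ : T′ ↔ T)
  (comm¹ : ∀ i e → Inverse.to v↔ (d¹′ i e) ≡ d¹ i (Inverse.to e↔ e))
  (comm² : ∀ i t → Inverse.to e↔ (d²′ i t) ≡ d² i (Inverse.to t↔ t)) where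

  private
    module S = Incidence d¹ d²
    module S′ = Incidence d¹′ d²′

    module V = Inverse v↔
    module E = Inverse e↔
    module T = Inverse t↔

    injective : ∀ {A B : Set} (i : A ↔ B) {x y} → Inverse.to i x ≡ Inverse.to i y → x ≡ y
    injective i = Injection.injective (↔⇒↣ i)

    edge→ : ∀ {e t} → e S′.EdgeOf t → E.to e S.EdgeOf T.to t
    edge→ (i , eq) = i , trans (sym (comm² i _)) (cong E.to eq)

    edge← : ∀ {e t} → E.to e S.EdgeOf T.to t → e S′.EdgeOf t
    edge← (i , eq) = i , injective e↔ (trans (comm² i _) eq)

    end→ : ∀ {v e} → v S′.EndOf e → V.to v S.EndOf E.to e
    end→ (i , eq) = i , trans (sym (comm¹ i _)) (cong V.to eq)

    end← : ∀ {v e} → V.to v S.EndOf E.to e → v S′.EndOf e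
    end← (i , eq) = i , injective v↔ (trans (comm¹ i _) eq)

    vertex→ : ∀ {v t} → v S′.VertexOf t → V.to v S.VertexOf T.to t
    vertex→ (e , e∈t , v∈e) = E.to e , edge→ e∈t , end→ v∈e

    at : ∀ {A B : Set} (i : A ↔ B) {P : B → Set} {y} → P y → P (Inverse.to i (Inverse.from i y))
    at i {P} = subst P (sym (Inverse.strictlyInverseˡ i _))

    d¹′-from : ∀ {i e v} → d¹ i e ≡ v → d¹′ i (E.from e) ≡ V.from v
    d¹′-from {i} {e} {v} eq = injective v↔ (begin
      V.to (d¹′ i (E.from e))   ≡⟨ comm¹ i _ ⟩
      d¹ i (E.to (E.from e))    ≡⟨ cong (d¹ i) (E.strictlyInverseˡ e) ⟩
      d¹ i e                    ≡⟨ eq ⟩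
      v                         ≡⟨ V.strictlyInverseˡ v ⟨
      V.to (V.from v)           ∎)
      where open ≡-Reasoning

    adjacent : ∀ {v w} → S.Adjacent v w → S′.Adjacent (V.from v) (V.from w)
    adjacent (e , inj₁ (p , q)) = E.from e , inj₁ (d¹′-from p , d¹′-from q)
    adjacent (e , inj₂ (p , q)) = E.from e , inj₂ (d¹′-from p , d¹′-from q)

    neighbours : ∀ {w u v} → S.Neighbours (V.to w) u v → S′.Neighbours w (T.from u) (T.from v)
    neighbours {w} {u} {v} (e , p , q , r) =
      E.from e , edge← (at e↔ {λ e → e S.EdgeOf (T.to (T.from u))} (at t↔ {e S.EdgeOf_} p)) , edge← (at e↔ {λ e → e S.EdgeOf (T.to (T.from v))} (at t↔ {e S.EdgeOf_} q)) ,
      end← (at e↔ {V.to w S.EndOf_} r)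

    simplicial : ∀ {i j k l x} → d¹ i (d² j (T.to x)) ≡ d¹ k (d² l (T.to x)) →
                 d¹′ i (d²′ j x) ≡ d¹′ k (d²′ l x)
    simplicial {i} {j} {k} {l} {x} eq = injective v↔ (trans (apart i j) (trans eq (sym (apart k l))))
      where
      apart : ∀ i j → V.to (d¹′ i (d²′ j x)) ≡ d¹ i (d² j (T.to x))
      apart i j = trans (comm¹ i _) (cong (d¹ i) (comm² j x))

  pseudosurface : S.IsPseudosurface → S′.IsPseudosurface
  pseudosurface S = record
    { d₀e₁            = λ x → simplicial (d₀e₁ (T.to x))
    ; d₀e₂            = λ x → simplicial (d₀e₂ (T.to x))
    ; d₁e₂            = λ x → simplicial (d₁e₂ (T.to x))
    ; connected       = λ v w v≢w →
        subst₂ (Star S′.Adjacent) (V.strictlyInverseʳ v) (V.strictlyInverseʳ w)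
          (gmap V.from adjacent (connected (V.to v) (V.to w) (v≢w ∘ injective v↔)))
    ; vertex-face     = λ w → let e , p = vertex-face (V.to w) in E.from e , end← (at e↔ {V.to w S.EndOf_} p)
    ; edge-face       = λ e → let t , p = edge-face (E.to e) in T.from t , edge← (at t↔ {E.to e S.EdgeOf_} p)
    ; edges-differ    = λ u i j i≢j eq → edges-differ (T.to u) i j i≢j
        (trans (sym (comm² i u)) (trans (cong E.to eq) (comm² j u)))
    ; vertices-differ = λ e i j i≢j eq → vertices-differ (E.to e) i j i≢j
        (trans (sym (comm¹ i e)) (trans (cong V.to eq) (comm¹ j e)))
    ; two-sided       = λ e → let u , v , u≢v , p , q , only = two-sided (E.to e) in
        T.from u , T.from v ,
        (λ eq → u≢v (trans (sym (T.strictlyInverseˡ u)) (trans (cong T.to eq) (T.strictlyInverseˡ v)))) ,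
        edge← (at t↔ {E.to e S.EdgeOf_} p) , edge← (at t↔ {E.to e S.EdgeOf_} q) ,
        λ t r → [ (λ eq → inj₁ (trans (sym (T.strictlyInverseʳ t)) (cong T.from eq)))
                , (λ eq → inj₂ (trans (sym (T.strictlyInverseʳ t)) (cong T.from eq))) ]′ (only (T.to t) (edge→ r))
    ; link-connected  = λ w u v p q →
        subst₂ (Star (S′.Neighbours w)) (T.strictlyInverseʳ u) (T.strictlyInverseʳ v)
          (gmap T.from neighbours (link-connected (V.to w) (T.to u) (T.to v) (vertex→ p) (vertex→ q)))
    }
    where open S.IsPseudosurface S

  orientedSurface : S.IsOrientedSurface → S′.IsOrientedSurface
  orientedSurface S = record
    { isPseudosurface = pseudosurface isPseudosurface
    ; inhabitant      = T.from inhabitant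
    ; orientation     = proj₁ orientation ∘ T.to , λ u v i j u≢v eq →
        proj₂ orientation (T.to u) (T.to v) i j (u≢v ∘ injective t↔)
          (trans (sym (comm² i u)) (trans (cong E.to eq) (comm² j v)))
    }
    where open S.IsOrientedSurface S

-- Deciding oriented surfaces over finite cell sets, and their complexes

module Finitary {n₀ n₁ n₂ : ℕ} (d¹ : Fin 2 → Fin n₁ → Fin n₀) (d² : Fin 3 → Fin n₂ → Fin n₁) where

  open Incidence d¹ d² hiding (IsPseudosurface; IsOrientedSurface)

  private
    star? : ∀ {n} {R : Fin n → Fin n → Set} → (∀ a b → Dec (R a b)) → ∀ a b → Dec (Star R a b)
    star? {n} R? a b = Star-dec {P = λ _ → ⊤} {xs = allFin n} (λ _ _ → tt) (λ _ → ∈-allFin _) Fin._≟_ R? tt b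

    edge? : ∀ e u → Dec (e EdgeOf u)
    edge? e u = Fin.any? λ i → d² i u Fin.≟ e

    end? : ∀ v e → Dec (v EndOf e)
    end? v e = Fin.any? λ i → d¹ i e Fin.≟ v

    vertex? : ∀ v u → Dec (v VertexOf u)
    vertex? v u = Fin.any? λ e → edge? e u ×-dec end? v e

    consistent? : ∀ side → Dec (Consistent side)
    consistent? side =
      Fin.all? λ u → Fin.all? λ v → Fin.all? λ i → Fin.all? λ j →
        ¬? (u Fin.≟ v) →-dec ((d² i u Fin.≟ d² j v) →-dec (_ ℤ.≟ 0ℤ))

    orientation? : Dec (∃ Consistent)
    orientation? = map′
      (λ (side , p) → lookup side , p)
      (λ (side , p) → tabulate side , λ u v i j u≢v eq →
        subst₂ (λ a b → parity (toℕ i) * parity (toℕ a) + parity (toℕ j) * parity (toℕ b) ≡ 0ℤ)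
          (sym (lookup∘tabulate side u)) (sym (lookup∘tabulate side v)) (p u v i j u≢v eq))
      (anyVec? n₂ λ side → consistent? (lookup side))

  isPseudosurface? : Dec (IsPseudosurface d¹ d²)
  isPseudosurface? = map′
    (λ (a , b , c , d , e , f , g , h , i , j) → record
      { d₀e₁ = a ; d₀e₂ = b ; d₁e₂ = c ; connected = d ; vertex-face = e ; edge-face = f
      ; edges-differ = g ; vertices-differ = h ; two-sided = i ; link-connected = j })
    (λ S → let open IsPseudosurface S in
      d₀e₁ , d₀e₂ , d₁e₂ , connected , vertex-face , edge-face
      , edges-differ , vertices-differ , two-sided , link-connected)
    ( (Fin.all? λ x → _ Fin.≟ _)
    ×-dec (Fin.all? λ x → _ Fin.≟ _)
    ×-dec (Fin.all? λ x → _ Fin.≟ _)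
    ×-dec (Fin.all? λ v → Fin.all? λ w → ¬? (v Fin.≟ w) →-dec star? adjacent? v w)
    ×-dec (Fin.all? λ w → Fin.any? λ e → end? w e)
    ×-dec (Fin.all? λ e → Fin.any? λ u → edge? e u)
    ×-dec (Fin.all? λ u → Fin.all? λ i → Fin.all? λ j → ¬? (i Fin.≟ j) →-dec ¬? (d² i u Fin.≟ d² j u))
    ×-dec (Fin.all? λ e → Fin.all? λ i → Fin.all? λ j → ¬? (i Fin.≟ j) →-dec ¬? (d¹ i e Fin.≟ d¹ j e))
    ×-dec (Fin.all? λ e → Fin.any? λ u → Fin.any? λ v →
             ¬? (u Fin.≟ v) ×-dec edge? e u ×-dec edge? e v ×-dec
             (Fin.all? λ t → edge? e t →-dec ((t Fin.≟ u) ⊎-dec (t Fin.≟ v))))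
    ×-dec (Fin.all? λ w → Fin.all? λ u → Fin.all? λ v →
             vertex? w u →-dec (vertex? w v →-dec star? (neighbours? w) u v)))
    where
    adjacent? : ∀ v w → Dec (Adjacent v w)
    adjacent? v w = Fin.any? λ e →
      ((d¹ zero e Fin.≟ v) ×-dec (d¹ (suc zero) e Fin.≟ w)) ⊎-dec
      ((d¹ zero e Fin.≟ w) ×-dec (d¹ (suc zero) e Fin.≟ v))

    neighbours? : ∀ w u v → Dec (Neighbours w u v)
    neighbours? w u v = Fin.any? λ e → edge? e u ×-dec edge? e v ×-dec end? w e

  isOrientedSurface? : Dec (IsOrientedSurface d¹ d²)
  isOrientedSurface? = map′
    (λ (a , (b , _) , c) → record { isPseudosurface = a ; inhabitant = b ; orientation = c })
    (λ S → let open IsOrientedSurface S in isPseudosurface , (inhabitant , tt) , orientation)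
    -- Searching with the trivial predicate decides whether there is a triangle at all.
    (isPseudosurface? ×-dec Fin.any? {P = λ _ → ⊤} (λ _ → yes tt) ×-dec orientation?)

  module _ (S : IsOrientedSurface d¹ d²) where

    open IsOrientedSurface S

    private
      Cell : ℕ → Set
      Cell 0 = Fin n₀
      Cell 1 = Fin n₁
      Cell 2 = Fin n₂
      Cell _ = ⊥

      d : ∀ n → Fin (suc (suc n)) → Cell (suc n) → Cell n
      d 0 = d¹
      d 1 = d²
      d (suc (suc n)) i ()

      d-d : ∀ n (j k : Fin (suc (suc n))) → j Fin.≤ k → ∀ x →
            d n j (d (suc n) (suc k) x) ≡ d n k (d (suc n) (inject₁ j) x)
      d-d 0 zero       zero       _ = d₀e₁
      d-d 0 zero       (suc zero) _ = d₀e₂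
      d-d 0 (suc zero) (suc zero) _ = d₁e₂
      d-d 0 (suc zero) zero       ()
      d-d (suc n) _ _ _ ()

    surfaceComplex : ΔComplex
    surfaceComplex = record { Cell = Cell ; d = d ; d-d = d-d }

    private
      cells↔ : Σ ℕ Cell ↔ (Fin n₀ ⊎ Fin n₁ ⊎ Fin n₂)
      cells↔ = mk↔ₛ′ to from
        (λ { (inj₁ _) → refl ; (inj₂ (inj₁ _)) → refl ; (inj₂ (inj₂ _)) → refl })
        (λ { (0 , _) → refl ; (1 , _) → refl ; (2 , _) → refl ; (suc (suc (suc _)) , ()) })
        where
        to : Σ ℕ Cell → Fin n₀ ⊎ Fin n₁ ⊎ Fin n₂
        to (0 , v) = inj₁ v
        to (1 , e) = inj₂ (inj₁ e)
        to (2 , t) = inj₂ (inj₂ t)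
        from : Fin n₀ ⊎ Fin n₁ ⊎ Fin n₂ → Σ ℕ Cell
        from (inj₁ v) = 0 , v
        from (inj₂ (inj₁ e)) = 1 , e
        from (inj₂ (inj₂ t)) = 2 , t

      finite : Finite (Σ ℕ Cell)
      finite = n₀ ℕ.+ (n₁ ℕ.+ n₂) ,
        Composition.inverse cells↔
          (Composition.inverse (↔-id _ ⊎-↔ Symmetry.inverse Fin.+↔⊎) (Symmetry.inverse Fin.+↔⊎))

      no-higher : ∀ m → 3 ℕ.≤ m → ¬ Cell m
      no-higher (suc (suc (suc m))) _ ()
      no-higher 1 (s≤s ())
      no-higher 2 (s≤s (s≤s ()))

      open Chains d¹ d² Fin._≟_ Fin._≟_ Fin._≟_
      open GroupMorphisms (Complex.Ker∂ surfaceComplex 1) +-0-rawGroup using (IsGroupIsomorphism)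

      xs = allFin n₂
      unique = Unique.allFin⁺ n₂

      deg : Expr (Fin n₂) → ℤ
      deg = degree S

      deg-isomorphism : IsGroupIsomorphism (deg ∘ proj₁)
      deg-isomorphism = record
        { isGroupMonomorphism = record
          { isGroupHomomorphism = record
            { isMonoidHomomorphism = record
              { isMagmaHomomorphism = record
                { isRelHomomorphism = record
                  { cong = degree-cong S }
                ; homo = λ (a , _) (b , _) → degree-⊕ S a b
                }
              ; ε-homo = degree-0# S
              }
            ; ⁻¹-homo = λ (a , _) → degree-⊖ S a
            }
          ; injective = λ {(a , ∂a)} {(b , ∂b)} → degree-injective S a b ∂a ∂b
          }
        ; surjective = λ k →
            (cycle S xs ∈-allFin unique k ,
             ∂-zero S (cycle S xs ∈-allFin unique k) k (coeff-cycle-multiple S xs ∈-allFin unique k)) ,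
            λ eq → trans (degree-cong S eq) (degree-cycle S xs ∈-allFin unique k)
        }

    surfaceComplex-isMComplex : IsMComplex surfaceComplex
    surfaceComplex-isMComplex = record
      { connected       = connected
      ; finite          = finite
      ; no-higher       = no-higher
      ; vertex-face     = vertex-face
      ; edge-face       = edge-face
      ; edges-differ    = edges-differ
      ; vertices-differ = vertices-differ
      ; two-sided       = two-sided
      ; link-connected  = link-connected
      ; H₂≅ℤ            = deg ∘ proj₁ , deg-isomorphism
      }

open Incidence using (IsPseudosurface; IsOrientedSurface)
-- Axioms up to rotations and switches

tabulate↔ : ∀ {A : Set} {n} (g : Fin n → A) → (∀ x → x ∈ List.tabulate g) → List.Unique (List.tabulate g) → Fin n ↔ A
tabulate↔ {A} g complete unique = mk↔ₛ′ g (proj₁ ∘ ∈-tabulate⁻ ∘ complete)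
  (λ x → sym (proj₂ (∈-tabulate⁻ (complete x))))
  (λ i → injective g unique (sym (proj₂ (∈-tabulate⁻ (complete (g i))))))
  where
  injective : ∀ {n} (g : Fin n → A) → List.Unique (List.tabulate g) → ∀ {i j} → g i ≡ g j → i ≡ j
  injective g _ {zero} {zero} _ = refl
  injective g (g₀ AllPairs.∷ _) {zero} {suc j} eq = contradiction eq (All.tabulate⁻ g₀ j)
  injective g (g₀ AllPairs.∷ _) {suc i} {zero} eq = contradiction (sym eq) (All.tabulate⁻ g₀ i)
  injective g (_ AllPairs.∷ unique) {suc i} {suc j} eq = cong suc (injective (g ∘ suc) unique eq)

unique↔ : ∀ {A : Set} (xs : List A) → (∀ x → x ∈ xs) → List.Unique xs → Fin (length xs) ↔ A
unique↔ xs complete unique = tabulate↔ (List.lookup xs)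
  (λ x → subst (x ∈_) (sym (tabulate-lookup xs)) (complete x))
  (subst List.Unique (sym (tabulate-lookup xs)) unique)

enumerated↔ : ∀ {A : Set} → DecidableEquality A → (xs : List A) → (∀ x → x ∈ xs) → ∃ λ n → Fin n ↔ A
enumerated↔ _≟_ xs complete =
  _ , unique↔ (deduplicate _≟_ xs) (∈-deduplicate⁺ _≟_ ∘ complete) (DecUnique.deduplicate-! _≟_ xs)

module _ {W : Set} where

  -- Read as a Menelaus configuration, a sextuple has the four lines BCP, CAQ, ABR, PQR. Rotation
  -- permutes the first three cyclically and fixes the last; the switch exchanges BCP with PQR and
  -- fixes the other two. Together they generate the symmetric group on the four lines of this
  -- complete quadrilateral.
  data Turn : Vec W 6 → Vec W 6 → Set where
    rotated  : ∀ {A B C P Q R} → Turn (A ∷ B ∷ C ∷ P ∷ Q ∷ R ∷ []) (B ∷ C ∷ A ∷ Q ∷ R ∷ P ∷ [])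
    switched : ∀ {A B C P Q R} → Turn (A ∷ B ∷ C ∷ P ∷ Q ∷ R ∷ []) (A ∷ R ∷ Q ∷ P ∷ C ∷ B ∷ [])

  infix 4 _~_

  _~_ : Vec W 6 → Vec W 6 → Set
  _~_ = Star Turn

  -- Rotation has order three and the switch order two.
  Turn-sym : ∀ {v w} → Turn v w → w ~ v
  Turn-sym rotated  = rotated ◅ rotated ◅ ε
  Turn-sym switched = switched ◅ ε

  ~-sym : ∀ {v w} → v ~ w → w ~ v
  ~-sym ε        = ε
  ~-sym (t ◅ ts) = ~-sym ts ◅◅ Turn-sym t

  Turn-All : ∀ {P : W → Set} {v w} → VAll.All P v → Turn v w → VAll.All P w
  Turn-All (a ∷ b ∷ c ∷ p ∷ q ∷ r ∷ []) rotated  = b ∷ c ∷ a ∷ q ∷ r ∷ p ∷ []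
  Turn-All (a ∷ b ∷ c ∷ p ∷ q ∷ r ∷ []) switched = a ∷ r ∷ q ∷ p ∷ c ∷ b ∷ []

  ~-All : ∀ {P : W → Set} {v w} → v ~ w → VAll.All P v → VAll.All P w
  ~-All ε        ps = ps
  ~-All (t ◅ ts) ps = ~-All ts (Turn-All ps t)

  All-∈-toList : ∀ {n} (v : Vec W n) → VAll.All (_∈ toList v) v
  All-∈-toList []      = []
  All-∈-toList (x ∷ v) = here refl ∷ VAll.map there (All-∈-toList v)

  module _ (_≟_ : DecidableEquality W) where

    Turn? : ∀ v w → Dec (Turn v w)
    Turn? (A ∷ B ∷ C ∷ P ∷ Q ∷ R ∷ []) w =
      map′ [ (λ { refl → rotated }) , (λ { refl → switched }) ]′
           (λ { rotated → inj₁ refl ; switched → inj₂ refl })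
           (≡-dec _≟_ w (B ∷ C ∷ A ∷ Q ∷ R ∷ P ∷ []) ⊎-dec
            ≡-dec _≟_ w (A ∷ R ∷ Q ∷ P ∷ C ∷ B ∷ []))

    _~?_ : ∀ v w → Dec (v ~ w)
    v ~? w = Star-dec Turn-All (∈-vectorsOver (toList v)) (≡-dec _≟_) Turn? (All-∈-toList v) w

  ⊢ᵃ-resp-~ : ∀ {φ ψ : Sextuple W} {Γ} → letters φ ~ letters ψ → ⊢ᵃ φ ∷ Γ → ⊢ᵃ ψ ∷ Γ
  ⊢ᵃ-resp-~ {sextuple v δ} {sextuple w δ′} = go v w δ δ′
    where
    go : ∀ v w .(δ : Vec.Unique v) .(δ′ : Vec.Unique w) {Γ} → v ~ w →
         ⊢ᵃ sextuple v δ ∷ Γ → ⊢ᵃ sextuple w δ′ ∷ Γ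
    go v .v δ δ′ ε d = d
    go _ w δ δ′ (rotated ◅ ts) d  = go _ w (rotate-distinct δ) δ′ ts (cutᵃ (rotateᵃ δ) d)
    go _ w δ δ′ (switched ◅ ts) d = go _ w (switch-distinct δ) δ′ ts (cutᵃ (switchᵃ δ) d)

  -- The starting point is the rotation axiom for `φ`. Its rotated member goes through two more
  -- rotations back to `φ` and then along `p` to `ψ`, so the case of `ε` is covered too.
  ~⇒⊢ᵃ : ∀ {φ ψ : Sextuple W} → letters φ ~ letters ψ → ⊢ᵃ φ ∷ ψ ∷ []
  ~⇒⊢ᵃ {sextuple (A ∷ B ∷ C ∷ P ∷ Q ∷ R ∷ []) δ} {ψ} p =
    exchangeᵃ (↭.swap ψ _ ↭-refl)
      (⊢ᵃ-resp-~ {sextuple _ (rotate-distinct δ)} {ψ} (rotated ◅ rotated ◅ p)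
        (exchangeᵃ (↭.swap _ _ ↭-refl) (rotateᵃ δ)))

  _≈ˢ_ : Sextuple W → Sextuple W → Set
  φ ≈ˢ ψ = letters φ ~ letters ψ

  ⊢ᵃ-resp-Pointwise : ∀ {Γ Γ′} Δ → Pointwise _≈ˢ_ Γ Γ′ → ⊢ᵃ Γ ++ Δ → ⊢ᵃ Γ′ ++ Δ
  ⊢ᵃ-resp-Pointwise Δ [] d = d
  ⊢ᵃ-resp-Pointwise Δ (_∷_ {ψ} {φ} {Γ} {Γ′} p ps) d =
    exchangeᵃ (shift φ Γ′ Δ)
      (⊢ᵃ-resp-Pointwise (φ ∷ Δ) ps
        (exchangeᵃ (↭-sym (shift φ Γ Δ)) (⊢ᵃ-resp-~ p d)))

  -- An axiom of the first kind with each member exchanged for a symmetric one; this closure is what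
  -- makes `Step` invariant under such exchanges.
  record Realized (Θ : List (Sextuple W)) : Set₁ where
    field
      {L}        : ΔComplex
      isMComplex : IsMComplex L
      ι          : (ΔComplex.Cell L 0 ⊎ ΔComplex.Cell L 1) ↣ W
      cells      : List (ΔComplex.Cell L 2)
      complete   : ∀ x → x ∈ cells
      unique     : List.Unique cells
      related    : Pointwise _≈ˢ_ (List.map (ν isMComplex ι) cells) Θ

  Realized⇒⊢ᵃ : ∀ {Θ} → Realized Θ → ⊢ᵃ Θ
  Realized⇒⊢ᵃ {Θ} r =
    exchangeᵃ (++-comm Θ []) (⊢ᵃ-resp-Pointwise [] related
      (exchangeᵃ (++-comm [] _) (complexᵃ isMComplex ι cells complete unique)))
    where open Realized r

  Realized-resp-↭ : ∀ {Θ Θ′} → Θ ↭ Θ′ → Realized Θ → Realized Θ′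
  Realized-resp-↭ p r
    with _ , q , related′ ← Pointwise-↭ (Realized.related r) p
    with cells′ , refl , q′ ← ↭-map-inv _ q = record
      { isMComplex = isMComplex
      ; ι          = ι
      ; cells      = cells′
      ; complete   = λ x → ∈-resp-↭ q′ (complete x)
      ; unique     = Unique-resp-↭ (setoid _) (↭⇒↭ₛ q′) unique
      ; related    = related′
      }
    where open Realized r

  Realized-resp-Pointwise : ∀ {Θ Θ′} → Pointwise _≈ˢ_ Θ Θ′ → Realized Θ → Realized Θ′
  Realized-resp-Pointwise ps r = record
    { isMComplex = isMComplex ; ι = ι ; cells = cells ; complete = complete ; unique = unique
    ; related = Pointwise.transitive _◅◅_ related ps }
    where open Realized r

  -- In a two-cell M-complex the cells have the same edges; which of them is
  -- dᵢ is then determined by the orientations of the edges.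
  module TwoCells {V E T : Set} {d¹ : Fin 2 → E → V} {d² : Fin 3 → T → E} (S : IsPseudosurface d¹ d²)
                  {x y : T} (only : ∀ t → t ≡ x ⊎ t ≡ y) where

    open Incidence d¹ d² hiding (IsPseudosurface; IsOrientedSurface)
    open IsPseudosurface S

    private
      -- The two different cells at an edge can only be `x` and `y`.
      shared : ∀ i → d² i x EdgeOf y
      shared i with u , v , u≢v , p , q , _ ← two-sided (d² i x) with only u | only v
      ... | inj₁ refl | inj₁ refl = contradiction refl u≢v
      ... | _         | inj₂ refl = q
      ... | inj₂ refl | _         = p

      π : Fin 3 → Fin 3
      π i = proj₁ (shared i)

      π-edge : ∀ i → d² (π i) y ≡ d² i x
      π-edge i = proj₂ (shared i)

      π-≢ : ∀ i j → i ≢ j → π i ≢ π j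
      π-≢ i j i≢j eq = edges-differ x i j i≢j
        (trans (sym (π-edge i)) (trans (cong (λ k → d² k y) eq) (π-edge j)))

      -- With A, B, C the vertices in order, faces 0, 1, 2 are the edges BC, AC, AB. Only face 2
      -- fails to end in C, and only face 0 fails to start in A.
      is-last is-first : Fin 3 → Bool
      is-last zero                = false
      is-last (suc zero)          = false
      is-last (suc (suc zero))    = true
      is-first zero               = true
      is-first (suc zero)         = false
      is-first (suc (suc zero))   = false

      source target : Fin 3 → V
      source i = d¹ (suc zero) (d² i y)
      target i = d¹ zero (d² i y)

      B≢C : target (suc (suc zero)) ≢ target zero
      B≢C eq = vertices-differ (d² zero y) zero (suc zero) (λ ()) (trans (sym eq) (d₀e₂ y))

      A≢B : source (suc (suc zero)) ≢ source zero
      A≢B eq = vertices-differ (d² (suc (suc zero)) y) (suc zero) zero (λ ()) (trans eq (sym (d₀e₂ y)))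

      target-last : ∀ i j → target i ≡ target j → is-last i ≡ is-last j
      target-last zero zero eq = refl
      target-last zero (suc zero) eq = refl
      target-last zero (suc (suc zero)) eq = contradiction (sym eq) B≢C
      target-last (suc zero) zero eq = refl
      target-last (suc zero) (suc zero) eq = refl
      target-last (suc zero) (suc (suc zero)) eq = contradiction (trans (sym eq) (d₀e₁ y)) B≢C
      target-last (suc (suc zero)) zero eq = contradiction eq B≢C
      target-last (suc (suc zero)) (suc zero) eq = contradiction (trans eq (d₀e₁ y)) B≢C
      target-last (suc (suc zero)) (suc (suc zero)) eq = refl

      source-first : ∀ i j → source i ≡ source j → is-first i ≡ is-first j
      source-first zero zero eq = refl
      source-first zero (suc zero) eq = contradiction (trans (d₁e₂ y) (sym eq)) A≢B
      source-first zero (suc (suc zero)) eq = contradiction (sym eq) A≢B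
      source-first (suc zero) zero eq = contradiction (trans (d₁e₂ y) eq) A≢B
      source-first (suc zero) (suc zero) eq = refl
      source-first (suc zero) (suc (suc zero)) eq = refl
      source-first (suc (suc zero)) zero eq = contradiction eq A≢B
      source-first (suc (suc zero)) (suc zero) eq = refl
      source-first (suc (suc zero)) (suc (suc zero)) eq = refl

      -- Two different faces agreeing in `is-last` are 0 and 1, which leaves 2 for `c`; agreeing in
      -- `is-first` then makes `b` face 1. All triples are checked by computation.
      π-determined : ∀ a b c → is-last a ≡ is-last b → is-first b ≡ is-first c →
                     a ≢ b → b ≢ c → a ≢ c → a ≡ zero × b ≡ suc zero × c ≡ suc (suc zero)
      π-determined = toWitness {a? = Fin.all? λ a → Fin.all? λ b → Fin.all? λ c →
        (is-last a Bool.≟ is-last b) →-dec ((is-first b Bool.≟ is-first c) →-dec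
          (¬? (a Fin.≟ b) →-dec (¬? (b Fin.≟ c) →-dec (¬? (a Fin.≟ c) →-dec
            ((a Fin.≟ zero) ×-dec (b Fin.≟ suc zero) ×-dec (c Fin.≟ suc (suc zero)))))))} _

      π-id : π zero ≡ zero × π (suc zero) ≡ suc zero × π (suc (suc zero)) ≡ suc (suc zero)
      π-id = π-determined _ _ _
        (target-last _ _ (trans (cong (d¹ zero) (π-edge zero)) (trans (sym (d₀e₁ x)) (cong (d¹ zero) (sym (π-edge (suc zero)))))))
        (source-first _ _ (trans (cong (d¹ (suc zero)) (π-edge (suc zero)))
          (trans (sym (d₁e₂ x)) (cong (d¹ (suc zero)) (sym (π-edge (suc (suc zero))))))))
        (π-≢ _ _ λ ()) (π-≢ _ _ λ ()) (π-≢ _ _ λ ())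

    same-edges : ∀ i → d² i y ≡ d² i x
    same-edges zero = trans (cong (λ k → d² k y) (sym (proj₁ π-id))) (π-edge zero)
    same-edges (suc zero) = trans (cong (λ k → d² k y) (sym (proj₁ (proj₂ π-id)))) (π-edge (suc zero))
    same-edges (suc (suc zero)) = trans (cong (λ k → d² k y) (sym (proj₂ (proj₂ π-id)))) (π-edge (suc (suc zero)))

  Realized-pair : ∀ {φ ψ} → Realized (φ ∷ ψ ∷ []) → φ ≈ˢ ψ
  Realized-pair r = go (Realized.cells r) (Realized.complete r) (Realized.related r)
    where
    open Realized r using (L; isMComplex; ι)
    open ΔComplex L

    go : ∀ xs {φ ψ} → (∀ x → x ∈ xs) → Pointwise _≈ˢ_ (List.map (ν isMComplex ι) xs) (φ ∷ ψ ∷ []) → φ ≈ˢ ψ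
    go (x ∷ y ∷ []) {ψ = ψ} complete (p ∷ q ∷ []) = ~-sym p ◅◅ subst (_~ letters ψ) (sym same-letters) q
      where
      only : ∀ t → t ≡ x ⊎ t ≡ y
      only t with complete t
      ... | here t≡x         = inj₁ t≡x
      ... | there (here t≡y) = inj₂ t≡y

      open TwoCells (mcomplex-isPseudosurface isMComplex) only

      same-letters : ν-letters isMComplex ι x ≡ ν-letters isMComplex ι y
      same-letters rewrite same-edges zero | same-edges (suc zero) | same-edges (suc (suc zero)) = refl

  -- Equality of vertices and of edges is pulled back from the alphabet along `ι`; triangles carry
  -- no letter of their own and are compared by their positions in the enumeration.
  module RealizedCells (_≟_ : DecidableEquality W) {Θ : List (Sextuple W)} (r : Realized Θ) where

    open Realized r
    open ΔComplex L
    open IsMComplex isMComplex using (two-sided)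

    _≟V_ : DecidableEquality (Cell 0)
    v ≟V w = map′ (inj₁-injective ∘ Injection.injective ι) (cong (Injection.to ι ∘ inj₁))
      (Injection.to ι (inj₁ v) ≟ Injection.to ι (inj₁ w))

    _≟E_ : DecidableEquality (Cell 1)
    e ≟E f = map′ (inj₂-injective ∘ Injection.injective ι) (cong (Injection.to ι ∘ inj₂))
      (Injection.to ι (inj₂ e) ≟ Injection.to ι (inj₂ f))

    _≟T_ : DecidableEquality (Cell 2)
    x ≟T y = map′ (λ eq → trans (sym (strictlyInverseˡ x)) (trans (cong to eq) (strictlyInverseˡ y))) (cong from)
      (from x Fin.≟ from y)
      where open Inverse (unique↔ cells complete unique)

    oriented : IsOrientedSurface (d 0) (d 1)
    oriented = mcomplex-isOrientedSurface isMComplex _≟V_ _≟E_ _≟T_ cells complete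

    -- There is a triangle, and any edge of it lies on two different ones.
    Realized-length : 2 ℕ.≤ length Θ
    Realized-length = subst (2 ℕ.≤_) (Pointwise.Pointwise-length related) (two cells complete)
      where
      triangle : Cell 2
      triangle = IsOrientedSurface.inhabitant oriented

      two : ∀ xs → (∀ x → x ∈ xs) → 2 ℕ.≤ length (List.map (ν isMComplex ι) xs)
      two [] all with () ← all triangle
      two (x ∷ []) all with u , v , u≢v , _ ← two-sided (d 1 zero x) with all u | all v
      ... | here p | here q = contradiction (trans p (sym q)) u≢v
      two (_ ∷ _ ∷ _) _ = s≤s (s≤s z≤n)

  -- Tables of faces and labels

  sequentLetters : List (Sextuple W) → List W
  sequentLetters = concatMap (toList ∘ letters)

  letters⊆ : ∀ {φ Θ} → φ ∈ Θ → VAll.All (_∈ sequentLetters Θ) (letters φ)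
  letters⊆ {φ} (here refl) = VAll.map ∈-++⁺ˡ (All-∈-toList (letters φ))
  letters⊆ (there {x = ψ} φ∈Θ) = VAll.map (∈-++⁺ʳ (toList (letters ψ))) (letters⊆ φ∈Θ)

  module _ {V E T : Set} (d¹ : Fin 2 → E → V) (d² : Fin 3 → T → E) (ℓV : V → W) (ℓE : E → W) where

    labels : T → Vec W 6
    labels t = ℓV (d¹ (suc zero) (d² (suc (suc zero)) t))
             ∷ ℓV (d¹ zero (d² (suc (suc zero)) t))
             ∷ ℓV (d¹ zero (d² zero t))
             ∷ ℓE (d² zero t) ∷ ℓE (d² (suc zero) t) ∷ ℓE (d² (suc (suc zero)) t) ∷ []

    record IsTabulation (θ : T → Vec W 6) : Set where
      field
        surface     : IsOrientedSurface d¹ d²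
        ℓV-injective : ∀ v w → ℓV v ≡ ℓV w → v ≡ w
        ℓE-injective : ∀ e f → ℓE e ≡ ℓE f → e ≡ f
        disjoint    : ∀ v e → ℓV v ≢ ℓE e
        labelled    : ∀ t → labels t ~ θ t

  module _ (_≟_ : DecidableEquality W) {n₀ n₁ n₂ : ℕ}
           (d¹ : Fin 2 → Fin n₁ → Fin n₀) (d² : Fin 3 → Fin n₂ → Fin n₁)
           (ℓV : Fin n₀ → W) (ℓE : Fin n₁ → W) (θ : Fin n₂ → Vec W 6) where

    isTabulation? : Dec (IsTabulation d¹ d² ℓV ℓE θ)
    isTabulation? = map′
      (λ (a , b , c , d , e) → record
        { surface = a ; ℓV-injective = b ; ℓE-injective = c ; disjoint = d ; labelled = e })
      (λ t → let open IsTabulation t in surface , ℓV-injective , ℓE-injective , disjoint , labelled)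
      ( Finitary.isOrientedSurface? d¹ d²
      ×-dec (Fin.all? λ v → Fin.all? λ w → (ℓV v ≟ ℓV w) →-dec (v Fin.≟ w))
      ×-dec (Fin.all? λ e → Fin.all? λ f → (ℓE e ≟ ℓE f) →-dec (e Fin.≟ f))
      ×-dec (Fin.all? λ v → Fin.all? λ e → ¬? (ℓV v ≟ ℓE e))
      ×-dec (Fin.all? λ t → _~?_ _≟_ (labels d¹ d² ℓV ℓE t) (θ t)))

  tabulation⇒Realized : ∀ {n₀ n₁} Θ {d¹ : Fin 2 → Fin n₁ → Fin n₀} {d² : Fin 3 → Fin (length Θ) → Fin n₁}
                        {ℓV : Fin n₀ → W} {ℓE : Fin n₁ → W} →
                        IsTabulation d¹ d² ℓV ℓE (letters ∘ List.lookup Θ) → Realized Θ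
  tabulation⇒Realized Θ {d¹} {d²} {ℓV} {ℓE} t = record
    { isMComplex = Finitary.surfaceComplex-isMComplex d¹ d² surface
    ; ι          = ι
    ; cells      = allFin (length Θ)
    ; complete   = ∈-allFin
    ; unique     = Unique.allFin⁺ (length Θ)
    ; related    = subst₂ (Pointwise _≈ˢ_) (sym (map-tabulate id _)) (tabulate-lookup Θ)
                     (Pointwise.tabulate⁺ labelled)
    }
    where
    open IsTabulation t

    ℓ-injective : ∀ x y → [ ℓV , ℓE ]′ x ≡ [ ℓV , ℓE ]′ y → x ≡ y
    ℓ-injective (inj₁ v) (inj₁ w) eq = cong inj₁ (ℓV-injective v w eq)
    ℓ-injective (inj₁ v) (inj₂ e) eq = contradiction eq (disjoint v e)
    ℓ-injective (inj₂ e) (inj₁ v) eq = contradiction (sym eq) (disjoint v e)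
    ℓ-injective (inj₂ e) (inj₂ f) eq = cong inj₂ (ℓE-injective e f eq)

    ι = mk↣ (ℓ-injective _ _)

  -- The faces and labels are vectors, so that they range over a finite type;
  -- labels point into the letters of Θ.
  module Table (Θ : List (Sextuple W)) where

    N = length (sequentLetters Θ)
    n = length Θ

    edge-faces : ∀ {n₀ n₁} → Vec (Fin n₀) n₁ → Vec (Fin n₀) n₁ → Fin 2 → Fin n₁ → Fin n₀
    edge-faces f₀ f₁ zero       = lookup f₀
    edge-faces f₀ f₁ (suc zero) = lookup f₁

    triangle-faces : ∀ {n₁} → (g₀ g₁ g₂ : Vec (Fin n₁) n) → Fin 3 → Fin n → Fin n₁
    triangle-faces g₀ g₁ g₂ zero             = lookup g₀
    triangle-faces g₀ g₁ g₂ (suc zero)       = lookup g₁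
    triangle-faces g₀ g₁ g₂ (suc (suc zero)) = lookup g₂

    label : ∀ {m} → Vec (Fin N) m → Fin m → W
    label l i = List.lookup (sequentLetters Θ) (lookup l i)

    -- Vertices and edges number at most `N` each, since their labels are injective and occur among
    -- the `N` letters of `Θ`. Triangles correspond to the members of `Θ`.
    Tabulated : Set
    Tabulated =
      ∃ λ n₀ → n₀ ℕ.< suc N × ∃ λ n₁ → n₁ ℕ.< suc N ×
      ∃ λ (f₀ : Vec (Fin n₀) n₁) → ∃ λ f₁ →
      ∃ λ (g₀ : Vec (Fin n₁) n) → ∃ λ g₁ → ∃ λ g₂ →
      ∃ λ l₀ → ∃ λ l₁ →
      IsTabulation (edge-faces f₀ f₁) (triangle-faces g₀ g₁ g₂) (label l₀) (label l₁) (letters ∘ List.lookup Θ)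

    Tabulated? : DecidableEquality W → Dec Tabulated
    Tabulated? _≟_ =
      ℕ.anyUpTo? (λ n₀ → ℕ.anyUpTo? (λ n₁ →
        anyVec? n₁ λ f₀ → anyVec? n₁ λ f₁ →
        anyVec? n λ g₀ → anyVec? n λ g₁ → anyVec? n λ g₂ →
        anyVec? n₀ λ l₀ → anyVec? n₁ λ l₁ → isTabulation? _≟_ _ _ _ _ _) _) _

    Tabulated⇒Realized : Tabulated → Realized Θ
    Tabulated⇒Realized (_ , _ , _ , _ , _ , _ , _ , _ , _ , _ , _ , t) = tabulation⇒Realized Θ t

  pointwise⇒tabulate : ∀ {A : Set} (f : A → Sextuple W) xs Θ → Pointwise _≈ˢ_ (List.map f xs) Θ →
                       ∃ λ (g : Fin (length Θ) → A) → xs ≡ List.tabulate g ×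
                         (∀ i → letters (f (g i)) ~ letters (List.lookup Θ i))
  pointwise⇒tabulate f [] [] [] = (λ ()) , refl , λ ()
  pointwise⇒tabulate f (x ∷ xs) (φ ∷ Θ) (p ∷ ps) with g , refl , q ← pointwise⇒tabulate f xs Θ ps =
    (λ { zero → x ; (suc i) → g i }) , refl , λ { zero → p ; (suc i) → q i }

  module _ (_≟_ : DecidableEquality W) {Θ : List (Sextuple W)} (r : Realized Θ) where

    open Realized r
    open RealizedCells _≟_ r
    open ΔComplex L
    open Table Θ

    private
      arrangement = pointwise⇒tabulate (ν isMComplex ι) cells Θ related
      g = proj₁ arrangement
      labelled = proj₂ (proj₂ arrangement)

      t↔ : Fin (length Θ) ↔ Cell 2
      t↔ = tabulate↔ g (λ x → subst (x ∈_) (proj₁ (proj₂ arrangement)) (complete x))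
                       (subst List.Unique (proj₁ (proj₂ arrangement)) unique)

      edges : List (Cell 1)
      edges = concatMap (λ t → d 1 zero t ∷ d 1 (suc zero) t ∷ d 1 (suc (suc zero)) t ∷ []) cells

      open IsOrientedSurface oriented using (vertex-face; edge-face; d₀e₁; d₀e₂; d₁e₂)

      edges-complete : ∀ e → e ∈ edges
      edges-complete e with t , e∈t ← edge-face e = ∈-concatMap⁺ _ (Any.map (λ { refl → here-edge e∈t }) (complete t))
        where
        here-edge : ∀ {e t} → Incidence._EdgeOf_ (d 0) (d 1) e t →
                    e ∈ d 1 zero t ∷ d 1 (suc zero) t ∷ d 1 (suc (suc zero)) t ∷ []
        here-edge (zero , refl)             = here refl
        here-edge (suc zero , refl)         = there (here refl)
        here-edge (suc (suc zero) , refl)   = there (there (here refl))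

      vertices : List (Cell 0)
      vertices = concatMap (λ e → d 0 zero e ∷ d 0 (suc zero) e ∷ []) edges

      vertices-complete : ∀ v → v ∈ vertices
      vertices-complete v with e , v∈e ← vertex-face v = ∈-concatMap⁺ _ (Any.map (λ { refl → here-end v∈e }) (edges-complete e))
        where
        here-end : ∀ {v e} → Incidence._EndOf_ (d 0) (d 1) v e → v ∈ d 0 zero e ∷ d 0 (suc zero) e ∷ []
        here-end (zero , refl)     = here refl
        here-end (suc zero , refl) = there (here refl)

      vertex-count = enumerated↔ _≟V_ vertices vertices-complete
      edge-count   = enumerated↔ _≟E_ edges edges-complete

      n₀ = proj₁ vertex-count
      n₁ = proj₁ edge-count
      v↔ = proj₂ vertex-count
      e↔ = proj₂ edge-count

      module V = Inverse v↔
      module E = Inverse e↔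
      module T = Inverse t↔

      vertexLabel : Cell 0 → W
      vertexLabel = Injection.to ι ∘ inj₁

      edgeLabel : Cell 1 → W
      edgeLabel = Injection.to ι ∘ inj₂

      -- Rotations and switches only permute the letters of a sextuple.
      labels⊆ : ∀ t → VAll.All (_∈ sequentLetters Θ) (ν-letters isMComplex ι t)
      labels⊆ t = subst (VAll.All _ ∘ ν-letters isMComplex ι) (T.strictlyInverseˡ t)
        (~-All (~-sym (labelled (T.from t))) (letters⊆ {Θ = Θ} (∈-lookup (T.from t))))

      edgeLabel∈ : ∀ e → edgeLabel e ∈ sequentLetters Θ
      edgeLabel∈ e with t , i , refl ← edge-face e with i | labels⊆ t
      ... | zero           | _ ∷ _ ∷ _ ∷ p ∷ _         = p
      ... | suc zero       | _ ∷ _ ∷ _ ∷ _ ∷ p ∷ _     = p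
      ... | suc (suc zero) | _ ∷ _ ∷ _ ∷ _ ∷ _ ∷ p ∷ _ = p

      vertexLabel∈ : ∀ v → vertexLabel v ∈ sequentLetters Θ
      vertexLabel∈ v with e , i , refl ← vertex-face v with t , j , refl ← edge-face e with i | j | labels⊆ t
      -- Each corner of a triangle is reached through two edges, and `ν` names it through one of
      -- them; the simplicial identities settle the other.
      ... | zero     | zero           | _ ∷ _ ∷ p ∷ _ = p
      ... | suc zero | zero           | _ ∷ p ∷ _     = subst (λ v → vertexLabel v ∈ _) (d₀e₂ t) p
      ... | zero     | suc zero       | _ ∷ _ ∷ p ∷ _ = subst (λ v → vertexLabel v ∈ _) (sym (d₀e₁ t)) p
      ... | suc zero | suc zero       | p ∷ _         = subst (λ v → vertexLabel v ∈ _) (d₁e₂ t) p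
      ... | zero     | suc (suc zero) | _ ∷ p ∷ _     = p
      ... | suc zero | suc (suc zero) | p ∷ _         = p

      module _ {A B : Set} {m k} (a↔ : Fin m ↔ A) (b↔ : Fin k ↔ B) (f : A → B) where
        column : Vec (Fin k) m
        column = tabulate (Inverse.from b↔ ∘ f ∘ Inverse.to a↔)

        column-correct : ∀ i → Inverse.to b↔ (lookup column i) ≡ f (Inverse.to a↔ i)
        column-correct i = trans (cong (Inverse.to b↔) (lookup∘tabulate _ i)) (Inverse.strictlyInverseˡ b↔ _)

      module _ {A : Set} {m} (a↔ : Fin m ↔ A) (ℓ : A → W) (ℓ∈ : ∀ a → ℓ a ∈ sequentLetters Θ) where
        labelColumn : Vec (Fin N) m
        labelColumn = tabulate (index ∘ ℓ∈ ∘ Inverse.to a↔)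

        label-correct : ∀ i → label labelColumn i ≡ ℓ (Inverse.to a↔ i)
        label-correct i = trans (cong (List.lookup (sequentLetters Θ)) (lookup∘tabulate _ i)) (sym (lookup-index (ℓ∈ _)))

        label-injective : (∀ {a b} → ℓ a ≡ ℓ b → a ≡ b) → ∀ i j → label labelColumn i ≡ label labelColumn j → i ≡ j
        label-injective inj i j eq = Injection.injective (↔⇒↣ a↔) (inj (trans (sym (label-correct i)) (trans eq (label-correct j))))

        bounded : (∀ {a b} → ℓ a ≡ ℓ b → a ≡ b) → m ℕ.< suc N
        bounded inj = s≤s (Fin.injective⇒≤ {f = lookup labelColumn}
          λ {i} {j} eq → label-injective inj i j (cong (List.lookup (sequentLetters Θ)) eq))

      d¹′ : Fin 2 → Fin n₁ → Fin n₀
      d¹′ = edge-faces (column e↔ v↔ (d 0 zero)) (column e↔ v↔ (d 0 (suc zero)))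

      d²′ : Fin 3 → Fin (length Θ) → Fin n₁
      d²′ = triangle-faces (column t↔ e↔ (d 1 zero)) (column t↔ e↔ (d 1 (suc zero))) (column t↔ e↔ (d 1 (suc (suc zero))))

      comm¹ : ∀ i e → V.to (d¹′ i e) ≡ d 0 i (E.to e)
      comm¹ zero       = column-correct e↔ v↔ (d 0 zero)
      comm¹ (suc zero) = column-correct e↔ v↔ (d 0 (suc zero))

      comm² : ∀ i t → E.to (d²′ i t) ≡ d 1 i (T.to t)
      comm² zero             = column-correct t↔ e↔ (d 1 zero)
      comm² (suc zero)       = column-correct t↔ e↔ (d 1 (suc zero))
      comm² (suc (suc zero)) = column-correct t↔ e↔ (d 1 (suc (suc zero)))

      l₀ = labelColumn v↔ vertexLabel vertexLabel∈
      l₁ = labelColumn e↔ edgeLabel edgeLabel∈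

      vertexLabel-injective : ∀ {v w} → vertexLabel v ≡ vertexLabel w → v ≡ w
      vertexLabel-injective = inj₁-injective ∘ Injection.injective ι

      edgeLabel-injective : ∀ {e f} → edgeLabel e ≡ edgeLabel f → e ≡ f
      edgeLabel-injective = inj₂-injective ∘ Injection.injective ι

      vertex-correct : ∀ i j t → label l₀ (d¹′ i (d²′ j t)) ≡ vertexLabel (d 0 i (d 1 j (T.to t)))
      vertex-correct i j t = trans (label-correct v↔ vertexLabel vertexLabel∈ _)
        (cong vertexLabel (trans (comm¹ i _) (cong (d 0 i) (comm² j t))))

      edge-correct : ∀ j t → label l₁ (d²′ j t) ≡ edgeLabel (d 1 j (T.to t))
      edge-correct j t = trans (label-correct e↔ edgeLabel edgeLabel∈ _) (cong edgeLabel (comm² j t))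

      labels-correct : ∀ t → labels d¹′ d²′ (label l₀) (label l₁) t ≡ ν-letters isMComplex ι (T.to t)
      labels-correct t =
        cong₂ _∷_ (vertex-correct (suc zero) (suc (suc zero)) t)
        (cong₂ _∷_ (vertex-correct zero (suc (suc zero)) t)
        (cong₂ _∷_ (vertex-correct zero zero t)
        (cong₂ _∷_ (edge-correct zero t)
        (cong₂ _∷_ (edge-correct (suc zero) t)
        (cong₂ _∷_ (edge-correct (suc (suc zero)) t) refl)))))

    Realized⇒Tabulated : Tabulated
    Realized⇒Tabulated =
      n₀ , bounded v↔ vertexLabel vertexLabel∈ vertexLabel-injective ,
      n₁ , bounded e↔ edgeLabel edgeLabel∈ edgeLabel-injective ,
      _ , _ , _ , _ , _ , l₀ , l₁ , record
        { surface      = Transport.orientedSurface v↔ e↔ t↔ comm¹ comm² oriented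
        ; ℓV-injective = label-injective v↔ vertexLabel vertexLabel∈ vertexLabel-injective
        ; ℓE-injective = label-injective e↔ edgeLabel edgeLabel∈ edgeLabel-injective
        ; disjoint     = λ v e eq → contradiction
            (Injection.injective ι (trans (sym (label-correct v↔ vertexLabel vertexLabel∈ v))
              (trans eq (label-correct e↔ edgeLabel edgeLabel∈ e)))) λ ()
        ; labelled     = λ t → subst (_~ letters (List.lookup Θ t)) (sym (labels-correct t)) (labelled t)
        }

  Realized? : DecidableEquality W → ∀ Θ → Dec (Realized Θ)
  Realized? _≟_ Θ = map′ (Table.Tabulated⇒Realized Θ) (Realized⇒Tabulated _≟_) (Table.Tabulated? Θ _≟_)

-- Renaming and the recursion on length

module Transposition {A : Set} (_≟_ : DecidableEquality A) where

  transpose : A → A → A → A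
  transpose i j x with x ≟ i | x ≟ j
  ... | yes _ | _     = j
  ... | no _  | yes _ = i
  ... | no _  | no _  = x

  transpose-left : ∀ i j → transpose i j i ≡ j
  transpose-left i j with i ≟ i | i ≟ j
  ... | yes _  | _ = refl
  ... | no i≢i | _ = contradiction refl i≢i

  transpose-right : ∀ i j → transpose i j j ≡ i
  transpose-right i j with j ≟ i | j ≟ j
  ... | yes j≡i | _       = j≡i
  ... | no _    | yes _   = refl
  ... | no _    | no j≢j  = contradiction refl j≢j

  transpose-other : ∀ {i j x} → x ≢ i → x ≢ j → transpose i j x ≡ x
  transpose-other {i} {j} {x} x≢i x≢j with x ≟ i | x ≟ j
  ... | yes x≡i | _       = contradiction x≡i x≢i
  ... | no _    | yes x≡j = contradiction x≡j x≢j
  ... | no _    | no _    = refl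

  transpose-involutive : ∀ i j x → transpose i j (transpose i j x) ≡ x
  transpose-involutive i j x = by-cases (x ≟ i) (x ≟ j)
    where
    by-cases : Dec (x ≡ i) → Dec (x ≡ j) → transpose i j (transpose i j x) ≡ x
    by-cases (yes refl) _ = trans (cong (transpose i j) (transpose-left i j)) (transpose-right i j)
    by-cases (no _) (yes refl) = trans (cong (transpose i j) (transpose-right i j)) (transpose-left i j)
    by-cases (no x≢i) (no x≢j) = trans (cong (transpose i j) (transpose-other x≢i x≢j)) (transpose-other x≢i x≢j)

  transposition : A → A → A ↣ A
  transposition i j = mk↣ {to = transpose i j} λ {x} {y} eq →
    trans (sym (transpose-involutive i j x)) (trans (cong (transpose i j) eq) (transpose-involutive i j y))

-- One finite stock `F` serves all sextuples `v`. The renaming is injective on the whole alphabet,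
-- so that it can be applied to derivations.
Pool : {W : Set} → List W → Set
Pool {W} V = ∃ λ F → ∀ (v : Vec W 6) → ∃ λ (π : W ↣ W) →
  (∀ {a} → a ∈ V → Injection.to π a ≡ a) × VAll.All (λ a → Injection.to π a ∈ F) v

module _ where

  open Transposition ℕ._≟_

  -- Each entry uses up at most one new slot: if the image of `a` is not yet below `m + k`,
  -- transposing that image with `m + k` brings it into range and moves nothing below `m + k`.
  compress : ∀ m {k} (v : Vec ℕ k) → ∃ λ (π : ℕ ↣ ℕ) →
             (∀ {a} → a ℕ.< m → Injection.to π a ≡ a) × VAll.All (λ a → Injection.to π a ℕ.< m ℕ.+ k) v
  compress m [] = ↣-id ℕ , (λ _ → refl) , []
  compress m {suc k} (a ∷ v) with π , fixed , below ← compress m v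
    with Injection.to π a ℕ.<? m ℕ.+ k
  ... | yes πa< = π , fixed , weaken πa< ∷ VAll.map weaken below
    where
    weaken : ∀ {x} → x ℕ.< m ℕ.+ k → x ℕ.< m ℕ.+ suc k
    weaken p = ℕ.<-≤-trans p (ℕ.+-monoʳ-≤ m (ℕ.n≤1+n k))
  ... | no πa≮ =
    Composition.injection π (transposition (to a) (m ℕ.+ k)) ,
    (λ {x} x<m → trans (cong swap (fixed x<m)) (unmoved (ℕ.<-≤-trans x<m (ℕ.m≤m+n m k)))) ,
    subst (ℕ._< m ℕ.+ suc k) (sym (transpose-left (to a) (m ℕ.+ k))) (ℕ.+-monoʳ-< m ℕ.≤-refl)
      ∷ VAll.map (λ {x} p → subst (ℕ._< m ℕ.+ suc k) (sym (unmoved p)) (ℕ.<-≤-trans p (ℕ.+-monoʳ-≤ m (ℕ.n≤1+n k)))) below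
    where
    to = Injection.to π
    swap = transpose (to a) (m ℕ.+ k)
    unmoved : ∀ {x} → x ℕ.< m ℕ.+ k → swap x ≡ x
    unmoved p = transpose-other (λ { refl → πa≮ p }) (ℕ.<⇒≢ p)

pool : ∀ {W : Set} → Countable W → (V : List W) → Pool V
pool {W} (inj₁ (n , i)) V = List.tabulate from , λ v →
  ↣-id W , (λ _ → refl) , VAll.universal (λ a → subst (_∈ _) (strictlyInverseʳ a) (∈-tabulate⁺ (to a))) v
  where open Inverse i
-- A sextuple brings in at most six letters outside `V`.
pool {W} (inj₂ i) V = List.map from (upTo (m ℕ.+ 6)) , λ v →
  let π , fixed , below = compress m (Vec.map to v) in
  Composition.injection (↔⇒↣ i) (Composition.injection π (↔⇒↣ (Symmetry.inverse i))) ,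
  (λ {a} a∈V → trans (cong from (fixed (small a∈V))) (strictlyInverseʳ a)) ,
  VAll.map (λ p → ∈-map⁺ from (∈-upTo⁺ p)) (VAll.map⁻ below)
  where
  open Inverse i
  m = suc (max 0 (List.map to V))
  small : ∀ {a} → a ∈ V → to a ℕ.< m
  small a∈V = s≤s (All.lookup (xs≤max 0 (List.map to V)) (∈-map⁺ to a∈V))

Countable⇒≟ : ∀ {W : Set} → Countable W → DecidableEquality W
Countable⇒≟ (inj₁ (_ , i)) = via-injection (↔⇒↣ i) Fin._≟_
Countable⇒≟ (inj₂ i)       = via-injection (↔⇒↣ i) ℕ._≟_

module _ {W : Set} where

  rename : W ↣ W → Sextuple W → Sextuple W
  rename π (sextuple v δ) = sextuple (Vec.map (Injection.to π) v) (VecUnique.map⁺ (Injection.injective π) δ)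

  rename-⊢ᵃ : ∀ π {Θ} → ⊢ᵃ Θ → ⊢ᵃ List.map (rename π) Θ
  rename-⊢ᵃ π (complexᵃ M ι xs complete unique) =
    subst ⊢ᵃ_ (map-∘ xs) (complexᵃ M (Composition.injection ι π) xs complete unique)
  rename-⊢ᵃ π (rotateᵃ δ) = rotateᵃ (VecUnique.map⁺ (Injection.injective π) δ)
  rename-⊢ᵃ π (switchᵃ δ) = switchᵃ (VecUnique.map⁺ (Injection.injective π) δ)
  rename-⊢ᵃ π (exchangeᵃ p d) = exchangeᵃ (map⁺ (rename π) p) (rename-⊢ᵃ π d)
  rename-⊢ᵃ π (cutᵃ {Γ} {Δ} d e) =
    subst ⊢ᵃ_ (sym (map-++ (rename π) Γ Δ)) (cutᵃ (rename-⊢ᵃ π d) (rename-⊢ᵃ π e))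
  rename-⊢ᵃ π (empty-cutᵃ {Γ} {Δ} d e) =
    subst ⊢ᵃ_ (sym (map-++ (rename π) Γ Δ)) (empty-cutᵃ (rename-⊢ᵃ π d) (rename-⊢ᵃ π e))

  rename-fixed : ∀ π Θ → (∀ {a} → a ∈ sequentLetters Θ → Injection.to π a ≡ a) → List.map (rename π) Θ ≡ Θ
  rename-fixed π Θ fixed = map-id-local (All.tabulate λ {φ} φ∈Θ → same φ (VAll.map fixed (letters⊆ {Θ = Θ} φ∈Θ)))
    where
    map-fixed : ∀ {n} {v : Vec W n} → VAll.All (λ a → Injection.to π a ≡ a) v → Vec.map (Injection.to π) v ≡ v
    map-fixed []       = refl
    map-fixed (p ∷ ps) = cong₂ _∷_ p (map-fixed ps)

    equal : ∀ {v w : Vec W 6} .{δ : Vec.Unique v} .{δ′ : Vec.Unique w} → v ≡ w → sextuple v δ ≡ sextuple w δ′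
    equal refl = refl

    same : ∀ φ → VAll.All (λ a → Injection.to π a ≡ a) (letters φ) → rename π φ ≡ φ
    same (sextuple v δ) ps = equal (map-fixed ps)

  sequentLetters-++ˡ : ∀ Γ {Δ : List (Sextuple W)} {a} → a ∈ sequentLetters Γ → a ∈ sequentLetters (Γ ++ Δ)
  sequentLetters-++ˡ (φ ∷ Γ) {Δ} a∈ = [ ∈-++⁺ˡ , ∈-++⁺ʳ (Vec.toList (letters φ)) ∘ sequentLetters-++ˡ Γ ]′
    (∈-++⁻ (Vec.toList (letters φ)) a∈)

  sequentLetters-++ʳ : ∀ Γ {Δ : List (Sextuple W)} {a} → a ∈ sequentLetters Δ → a ∈ sequentLetters (Γ ++ Δ)
  sequentLetters-++ʳ []      a∈ = a∈
  sequentLetters-++ʳ (φ ∷ Γ) a∈ = ∈-++⁺ʳ (Vec.toList (letters φ)) (sequentLetters-++ʳ Γ a∈)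

  CutFormula : List (Sextuple W) → List (Sextuple W) → Set₁
  CutFormula Γ Δ = ∃ λ φ → (⊢ᵃ φ ∷ Γ) × (⊢ᵃ φ ∷ Δ)

  -- Both premises are renamed by the same `π`. It fixes the letters of `Γ` and `Δ`, so only the cut
  -- formula moves, into the pool.
  cutFormula? : DecidableEquality W → ∀ {Γ Δ} → Pool (sequentLetters (Γ ++ Δ)) →
                (∀ φ → Dec (⊢ᵃ φ ∷ Γ)) → (∀ φ → Dec (⊢ᵃ φ ∷ Δ)) → Dec (CutFormula Γ Δ)
  cutFormula? _≟_ {Γ} {Δ} (F , renameInto) Γ? Δ? =
    map′ sound complete
         (Any.any? at? (vectorsOver F 6))
    where
    At : Vec W 6 → Set₁
    At v = Σ (Vec.Unique v) λ δ → (⊢ᵃ sextuple v δ ∷ Γ) × (⊢ᵃ sextuple v δ ∷ Δ)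

    at? : ∀ v → Dec (At v)
    at? v with VAllPairs.allPairs? (λ a b → ¬? (a ≟ b)) v
    ... | no ¬δ = no (¬δ ∘ proj₁)
    ... | yes δ = map′ (δ ,_) proj₂ (Γ? (sextuple v δ) ×-dec Δ? (sextuple v δ))

    -- A sextuple holds its distinctness irrelevantly, while `At` needs it as data; deciding it
    -- recovers it.
    unique : ∀ {v} → .(Vec.Unique v) → Vec.Unique v
    unique {v} δ = recompute (VAllPairs.allPairs? (λ a b → ¬? (a ≟ b)) v) δ

    sound : Any.Any At (vectorsOver F 6) → CutFormula Γ Δ
    sound found with v , δ , d , e ← Any.satisfied found = sextuple v δ , d , e

    complete : CutFormula Γ Δ → Any.Any At (vectorsOver F 6)
    complete (sextuple v δ , d , e) with π , fixed , into ← renameInto v =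
      lose (∈-vectorsOver F (VAll.map⁺ into))
        ( VecUnique.map⁺ (Injection.injective π) (unique δ)
        , subst (λ Γ → ⊢ᵃ _ ∷ Γ) (rename-fixed π Γ (fixed ∘ sequentLetters-++ˡ Γ)) (rename-⊢ᵃ π d)
        , subst (λ Δ → ⊢ᵃ _ ∷ Δ) (rename-fixed π Δ (fixed ∘ sequentLetters-++ʳ Γ)) (rename-⊢ᵃ π e) )

  -- Analysis of the last rule, and the decision by length

  data Step (Θ : List (Sextuple W)) : Set₁ where
    realized : Realized Θ → Step Θ
    related  : ∀ {φ ψ} → Θ ↭ φ ∷ ψ ∷ [] → φ ≈ˢ ψ → Step Θ
    joined   : ∀ {Γ Δ} → Θ ↭ Γ ++ Δ → ⊢ᵃ Γ → ⊢ᵃ Δ → Step Θ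
    cutting  : ∀ {Γ Δ} → Θ ↭ Γ ++ Δ → 2 ℕ.≤ length Γ → 2 ℕ.≤ length Δ → CutFormula Γ Δ → Step Θ

  Step⇒⊢ᵃ : ∀ {Θ} → Step Θ → ⊢ᵃ Θ
  Step⇒⊢ᵃ (realized r)                  = Realized⇒⊢ᵃ r
  Step⇒⊢ᵃ (related p φ~ψ)               = exchangeᵃ (↭-sym p) (~⇒⊢ᵃ φ~ψ)
  Step⇒⊢ᵃ (joined p d e)                = exchangeᵃ (↭-sym p) (empty-cutᵃ d e)
  Step⇒⊢ᵃ (cutting p _ _ (_ , d , e))   = exchangeᵃ (↭-sym p) (cutᵃ d e)

  Step-resp-↭ : ∀ {Θ Θ′} → Θ ↭ Θ′ → Step Θ → Step Θ′
  Step-resp-↭ q (realized r)      = realized (Realized-resp-↭ q r)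
  Step-resp-↭ q (related p φ~ψ)   = related (↭-trans (↭-sym q) p) φ~ψ
  Step-resp-↭ q (joined p d e)    = joined (↭-trans (↭-sym q) p) d e
  Step-resp-↭ q (cutting p k l c) = cutting (↭-trans (↭-sym q) p) k l c

  ↭-pair-inv : ∀ {φ φ′ ψ′ : Sextuple W} {Γ} → φ ∷ Γ ↭ φ′ ∷ ψ′ ∷ [] →
               (φ ≡ φ′ × Γ ≡ ψ′ ∷ []) ⊎ (φ ≡ ψ′ × Γ ≡ φ′ ∷ [])
  ↭-pair-inv p with ∷↭∷-inv p
  ... | inj₁ (refl , q) = inj₁ (refl , ↭-singleton-inv q)
  ... | inj₂ (zs , q , r) with refl ← ↭-singleton-inv (↭-sym r) = inj₂ (refl , ↭-singleton-inv q)

  -- For `joined` and `cutting` the exchange is pushed into the premise containing the member, which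
  -- leaves the lengths of the parts unchanged.
  Step-resp-~ : ∀ {φ ψ Γ} → φ ≈ˢ ψ → Step (φ ∷ Γ) → Step (ψ ∷ Γ)
  Step-resp-~ φ~ψ (realized r) = realized (Realized-resp-Pointwise (φ~ψ ∷ Pointwise.refl ε) r)
  Step-resp-~ {φ} {ψ} φ~ψ (related p q) with ↭-pair-inv p
  ... | inj₁ (refl , refl) = related {φ = ψ} ↭-refl (~-sym φ~ψ ◅◅ q)
  ... | inj₂ (refl , refl) = related {φ = ψ} ↭-refl (~-sym φ~ψ ◅◅ ~-sym q)
  Step-resp-~ {φ} {ψ} φ~ψ (joined {Γ₁} {Γ₂} p d e) with ∷↭++-inv Γ₁ p
  ... | inj₁ (Γ₁′ , q , r) = joined (prep ψ r) (⊢ᵃ-resp-~ φ~ψ (exchangeᵃ q d)) e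
  ... | inj₂ (Γ₂′ , q , r) =
    joined (↭-trans (prep ψ r) (↭-sym (shift ψ Γ₁ Γ₂′))) d (⊢ᵃ-resp-~ φ~ψ (exchangeᵃ q e))
  Step-resp-~ {φ} {ψ} φ~ψ (cutting {Γ₁} {Γ₂} p k l (χ , d , e)) with ∷↭++-inv Γ₁ p
  ... | inj₁ (Γ₁′ , q , r) =
    cutting {Γ = ψ ∷ Γ₁′} (prep ψ r) (subst (2 ℕ.≤_) (↭-length q) k) l (χ , replace q d , e)
    where
    replace : ∀ {Γ Γ′} → Γ ↭ φ ∷ Γ′ → ⊢ᵃ χ ∷ Γ → ⊢ᵃ χ ∷ ψ ∷ Γ′
    replace q d = exchangeᵃ (↭.swap ψ χ ↭-refl) (⊢ᵃ-resp-~ φ~ψ (exchangeᵃ (↭-trans (prep χ q) (↭.swap χ φ ↭-refl)) d))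
  ... | inj₂ (Γ₂′ , q , r) =
    cutting {Δ = ψ ∷ Γ₂′} (↭-trans (prep ψ r) (↭-sym (shift ψ Γ₁ Γ₂′))) k (subst (2 ℕ.≤_) (↭-length q) l) (χ , d , replace q e)
    where
    replace : ∀ {Γ Γ′} → Γ ↭ φ ∷ Γ′ → ⊢ᵃ χ ∷ Γ → ⊢ᵃ χ ∷ ψ ∷ Γ′
    replace q d = exchangeᵃ (↭.swap ψ χ ↭-refl) (⊢ᵃ-resp-~ φ~ψ (exchangeᵃ (↭-trans (prep χ q) (↭.swap χ φ ↭-refl)) d))

  complex-realized : ∀ {L} (M : IsMComplex L) (ι : (ΔComplex.Cell L 0 ⊎ ΔComplex.Cell L 1) ↣ W) xs → (∀ x → x ∈ xs) → List.Unique xs → Realized (List.map (ν M ι) xs)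
  complex-realized M ι xs complete unique = record
    { isMComplex = M ; ι = ι ; cells = xs ; complete = complete ; unique = unique ; related = Pointwise.refl ε }

  module _ (W-countable : Countable W) where

    private
      _≟_ = Countable⇒≟ W-countable

    -- Each premise of a cut has a member besides the cut formula, so one from each remains in the
    -- conclusion.
    ⊢ᵃ-length : ∀ {Θ : List (Sextuple W)} → ⊢ᵃ Θ → 2 ℕ.≤ length Θ
    ⊢ᵃ-length (complexᵃ M ι xs complete unique) =
      RealizedCells.Realized-length _≟_ (complex-realized M ι xs complete unique)
    ⊢ᵃ-length (rotateᵃ _) = ℕ.≤-refl
    ⊢ᵃ-length (switchᵃ _) = ℕ.≤-refl
    ⊢ᵃ-length (exchangeᵃ p d) = subst (2 ℕ.≤_) (↭-length p) (⊢ᵃ-length d)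
    ⊢ᵃ-length (cutᵃ {Γ} {Δ} d e) = subst (2 ℕ.≤_) (sym (length-++ Γ {Δ}))
      (ℕ.+-mono-≤ (ℕ.s≤s⁻¹ (⊢ᵃ-length d)) (ℕ.s≤s⁻¹ (⊢ᵃ-length e)))
    ⊢ᵃ-length (empty-cutᵃ {Γ} {Δ} d e) = subst (2 ℕ.≤_) (sym (length-++ Γ {Δ}))
      (ℕ.≤-trans (⊢ᵃ-length d) (ℕ.m≤m+n _ _))

    split-length : ∀ {Θ} Γ (Δ : List (Sextuple W)) → Θ ↭ Γ ++ Δ → length Θ ≡ length Γ ℕ.+ length Δ
    split-length Γ Δ p = trans (↭-length p) (length-++ Γ)

    pair-unsplit : ∀ {φ ψ : Sextuple W} Γ Δ → φ ∷ ψ ∷ [] ↭ Γ ++ Δ → 2 ℕ.≤ length Γ → ¬ 2 ℕ.≤ length Δ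
    pair-unsplit Γ Δ p k l with s≤s (s≤s ()) ← subst (4 ℕ.≤_) (sym (split-length Γ Δ p)) (ℕ.+-mono-≤ k l)

    -- Empty cuts and proper cuts are excluded, because their two parts would have four members in
    -- all.
    Step-pair : ∀ {φ ψ} → Step (φ ∷ ψ ∷ []) → φ ≈ˢ ψ
    Step-pair (realized r) = Realized-pair r
    Step-pair (related p q) with ↭-pair-inv p
    ... | inj₁ (refl , refl) = q
    ... | inj₂ (refl , refl) = ~-sym q
    Step-pair (joined {Γ} {Δ} p d e)    = contradiction (⊢ᵃ-length e) (pair-unsplit Γ Δ p (⊢ᵃ-length d))
    Step-pair (cutting {Γ} {Δ} p k l _) = contradiction l (pair-unsplit Γ Δ p k)

    ⊢ᵃ⇒Step : ∀ {Θ : List (Sextuple W)} → ⊢ᵃ Θ → Step Θ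
    ⊢ᵃ⇒Step (complexᵃ M ι xs complete unique) = realized (complex-realized M ι xs complete unique)
    ⊢ᵃ⇒Step (rotateᵃ δ)      = related ↭-refl (rotated ◅ ε)
    ⊢ᵃ⇒Step (switchᵃ δ)      = related ↭-refl (switched ◅ ε)
    ⊢ᵃ⇒Step (exchangeᵃ p d)  = Step-resp-↭ p (⊢ᵃ⇒Step d)
    ⊢ᵃ⇒Step (empty-cutᵃ d e) = joined ↭-refl d e
    ⊢ᵃ⇒Step (cutᵃ {[]} d e) with s≤s () ← ⊢ᵃ-length d
    ⊢ᵃ⇒Step (cutᵃ {_ ∷ _} {[]} d e) with s≤s () ← ⊢ᵃ-length e
    -- The first premise only relates the cut formula to `γ`, so the conclusion is the second
    -- premise with the cut formula exchanged for `γ`.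
    ⊢ᵃ⇒Step (cutᵃ {γ ∷ []} d e) = Step-resp-~ (Step-pair (⊢ᵃ⇒Step d)) (⊢ᵃ⇒Step e)
    ⊢ᵃ⇒Step (cutᵃ {Γ} {δ ∷ []} d e) =
      Step-resp-↭ (++-comm (δ ∷ []) Γ) (Step-resp-~ (Step-pair (⊢ᵃ⇒Step e)) (⊢ᵃ⇒Step d))
    ⊢ᵃ⇒Step (cutᵃ {_ ∷ _ ∷ _} {_ ∷ _ ∷ _} d e) =
      cutting ↭-refl (s≤s (s≤s z≤n)) (s≤s (s≤s z≤n)) (_ , d , e)

    related? : ∀ Θ → Dec (∃₂ λ φ ψ → Θ ↭ φ ∷ ψ ∷ [] × φ ≈ˢ ψ)
    related? [] = no λ { (_ , _ , p , _) → contradiction (↭-length p) λ () }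
    related? (_ ∷ []) = no λ { (_ , _ , p , _) → contradiction (↭-length p) λ () }
    related? (_ ∷ _ ∷ _ ∷ _) = no λ { (_ , _ , p , _) → contradiction (↭-length p) λ () }
    related? (φ ∷ ψ ∷ []) = map′ (λ q → φ , ψ , ↭-refl , q)
      (λ (_ , _ , p , q) → Step-pair (related p q)) (_~?_ _≟_ (letters φ) (letters ψ))

    ⊢ᵃ?-acc : (Θ : List (Sextuple W)) → Acc ℕ._<_ (length Θ) → Dec (⊢ᵃ Θ)
    ⊢ᵃ?-acc Θ (acc rec) = map′
      [ Step⇒⊢ᵃ ∘ realized , [ (λ (_ , _ , p , q) → Step⇒⊢ᵃ (related p q)) ,
        [ (λ (_ , _ , p , d , e) → Step⇒⊢ᵃ (joined p d e))
        , (λ (_ , _ , p , k , l , c) → Step⇒⊢ᵃ (cutting p k l c)) ]′ ]′ ]′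
      (from ∘ ⊢ᵃ⇒Step)
      (Realized? _≟_ Θ ⊎-dec related? Θ ⊎-dec joined? ⊎-dec cutting?)
      where
      Joined Cutting : Set₁
      Joined = ∃₂ λ Γ Δ → Θ ↭ Γ ++ Δ × (⊢ᵃ Γ) × (⊢ᵃ Δ)
      Cutting = ∃₂ λ Γ Δ → Θ ↭ Γ ++ Δ × 2 ℕ.≤ length Γ × 2 ℕ.≤ length Δ × CutFormula Γ Δ

      from : Step Θ → Realized Θ ⊎ (∃₂ λ φ ψ → Θ ↭ φ ∷ ψ ∷ [] × φ ≈ˢ ψ) ⊎ Joined ⊎ Cutting
      from (realized r)      = inj₁ r
      from (related p q)     = inj₂ (inj₁ (_ , _ , p , q))
      from (joined p d e)    = inj₂ (inj₂ (inj₁ (_ , _ , p , d , e)))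
      from (cutting p k l c) = inj₂ (inj₂ (inj₂ (_ , _ , p , k , l , c)))

      -- The successor accounts for the cut formula: each part must outweigh the one added to the
      -- other, hence the bound 2.
      shorter : ∀ {a b} → length Θ ≡ a ℕ.+ b → 2 ℕ.≤ a → 2 ℕ.≤ b → suc a ℕ.< length Θ × suc b ℕ.< length Θ
      shorter {a} {b} eq k l =
        subst (suc a ℕ.<_) (sym eq) (subst (ℕ._≤ a ℕ.+ b) (ℕ.+-comm a 2) (ℕ.+-monoʳ-≤ a l)) ,
        subst (suc b ℕ.<_) (sym eq) (ℕ.+-monoˡ-≤ b k)

      -- Lengths are tested first: a part with fewer than two members is not derivable, and an empty
      -- part would leave the other as long as `Θ`.
      joined? : Dec Joined
      joined? = any-split? Θ (λ q r (d , e) → exchangeᵃ q d , exchangeᵃ r e) λ Γ Δ p →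
        both Γ Δ p (2 ℕ.≤? length Γ) (2 ℕ.≤? length Δ)
        where
        both : ∀ Γ Δ → Θ ↭ Γ ++ Δ → Dec (2 ℕ.≤ length Γ) → Dec (2 ℕ.≤ length Δ) → Dec ((⊢ᵃ Γ) × (⊢ᵃ Δ))
        both Γ Δ p (no k) _       = no (k ∘ ⊢ᵃ-length ∘ proj₁)
        both Γ Δ p (yes _) (no l) = no (l ∘ ⊢ᵃ-length ∘ proj₂)
        both Γ Δ p (yes k) (yes l) =
          let a , b = shorter (split-length Γ Δ p) k l in
          ⊢ᵃ?-acc Γ (rec (ℕ.m+n≤o⇒n≤o 1 a)) ×-dec ⊢ᵃ?-acc Δ (rec (ℕ.m+n≤o⇒n≤o 1 b))

      cutting? : Dec Cutting
      cutting? = any-split? Θ transport λ Γ Δ p → both Γ Δ p (2 ℕ.≤? length Γ) (2 ℕ.≤? length Δ)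
        where
        transport : ∀ {Γ Γ′ Δ Δ′} → Γ ↭ Γ′ → Δ ↭ Δ′ →
               2 ℕ.≤ length Γ × 2 ℕ.≤ length Δ × CutFormula Γ Δ → 2 ℕ.≤ length Γ′ × 2 ℕ.≤ length Δ′ × CutFormula Γ′ Δ′
        transport q r (k , l , φ , d , e) = subst (2 ℕ.≤_) (↭-length q) k , subst (2 ℕ.≤_) (↭-length r) l ,
          φ , exchangeᵃ (prep φ q) d , exchangeᵃ (prep φ r) e

        both : ∀ Γ Δ → Θ ↭ Γ ++ Δ → Dec (2 ℕ.≤ length Γ) → Dec (2 ℕ.≤ length Δ) →
               Dec (2 ℕ.≤ length Γ × 2 ℕ.≤ length Δ × CutFormula Γ Δ)
        both Γ Δ p (no k) _       = no (k ∘ proj₁)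
        both Γ Δ p (yes _) (no l) = no (l ∘ proj₁ ∘ proj₂)
        both Γ Δ p (yes k) (yes l) =
          let a , b = shorter (split-length Γ Δ p) k l in
          map′ (λ c → k , l , c) (proj₂ ∘ proj₂)
            (cutFormula? _≟_ (pool W-countable _)
              (λ φ → ⊢ᵃ?-acc (φ ∷ Γ) (rec a)) (λ φ → ⊢ᵃ?-acc (φ ∷ Δ) (rec b)))

    ⊢ᵃ? : (Θ : List (Sextuple W)) → Dec (⊢ᵃ Θ)
    ⊢ᵃ? Θ = ⊢ᵃ?-acc Θ (<-wellFounded (length Θ))

proposition9p1 : (W : Set) → Countable W → (Γ : Sequent W) → Dec (⊢ Γ)
proposition9p1 W W-countable = ⊢? (⊢ᵃ? W-countable)
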